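{- Let $G$ be a finite simple undirected graph of order $n$ with fewer than $\frac{11}{5}n-\frac{18}{5}$ edges. Then $G$ has a forest cut.
   Context: A vertex cut of a graph $G$ is a set $S\subseteq V(G)$ such that $G-S$ is disconnected. A forest cut of $G$ is a vertex cut $S$ such that the induced subgraph $G[S]$ is a forest (acyclic). -}

module Defs where

open import Data.Nat using (ℕ; zero; suc; _+_; _*_; _<_; _≥_)
open import Data.Bool using (Bool; true; false; T; if_then_else_; _∧_)
open import Data.Fin using (Fin; toℕ)
open import Data.Fin.Subset using (Subset; _∈_; _∉_)
open import Data.List using (List; []; _∷_; length; map; allFin; last)
open import Data.Nat.ListAction using (sum)
open import Data.Empty using (⊥)
open import Data.List.Relation.Unary.All using (All)
open import Data.List.Relation.Unary.Unique.Propositional using (Unique)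
open import Data.List.Relation.Unary.Linked using (Linked)
open import Data.Maybe using (just)
open import Data.Product using (Σ; _×_; ∃; ∃-syntax)
open import Relation.Nullary using (¬_)
open import Relation.Nullary.Decidable using (⌊_⌋)
open import Relation.Binary.PropositionalEquality using (_≡_)
import Data.Nat as ℕ

record Graph (n : ℕ) : Set where
  field
    adj       : Fin n → Fin n → Bool
    symmetric : ∀ i j → adj i j ≡ adj j i
    irreflexive : ∀ i → adj i i ≡ false

open Graph public

Adj : ∀ {n} → Graph n → Fin n → Fin n → Set
Adj G i j = T (adj G i j)

edgeCount : ∀ {n} → Graph n → ℕ
edgeCount {n} G =
  sum (map (λ i → sum (map (λ j →
        if ⌊ toℕ i ℕ.<? toℕ j ⌋ ∧ adj G i j then 1 else 0) (allFin n))) (allFin n))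

data ReachAvoiding {n} (G : Graph n) (S : Subset n) : Fin n → Fin n → Set where
  here : ∀ {u} → u ∉ S → ReachAvoiding G S u u
  step : ∀ {u w v} → u ∉ S → Adj G u w → ReachAvoiding G S w v → ReachAvoiding G S u v

Disconnected-minus : ∀ {n} → Graph n → Subset n → Set
Disconnected-minus G S =
  ∃[ u ] ∃[ v ] (u ∉ S × v ∉ S × ¬ ReachAvoiding G S u v)

VertexCut : ∀ {n} → Graph n → Subset n → Set
VertexCut G S = Disconnected-minus G S

CycleIn : ∀ {n} → Graph n → Subset n → List (Fin n) → Set
CycleIn G S [] = ⊥
CycleIn G S (v ∷ vs) =
  (3 ℕ.≤ length (v ∷ vs)) × Unique (v ∷ vs) × All (_∈ S) (v ∷ vs)
  × Linked (Adj G) (v ∷ vs) × ∃[ w ] (last (v ∷ vs) ≡ just w × Adj G w v)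

InducedForest : ∀ {n} → Graph n → Subset n → Set
InducedForest G S = ∀ (c : List (Fin _)) → ¬ CycleIn G S c

ForestCut : ∀ {n} → Graph n → Subset n → Set
ForestCut G S = VertexCut G S × InducedForest G S

{-# OPTIONS --safe #-}

-- A cut is found by induction on the number of vertices.  If the neighbourhood of a vertex, or of
-- two adjacent vertices, induces a forest, it is a forest cut.  Otherwise a vertex of degree three
-- has a triangle as neighbourhood and can be deleted, since a forest leaves at least one vertex of
-- the triangle and does not separate the rest.  For a vertex u of degree four, either u and a
-- triangle in N(u) form a K₄ and the fourth neighbour has at most one neighbour in the triangle,
-- or N(u) misses only disjoint pairs; then u is deleted and one missing pair is joined (three edges
-- are lost, 11/5 suffice).  If two vertices of degree four lie in such a K₄, both are deleted and
-- up to two edges are added (five are lost, 22/5 suffice).  So every remaining vertex of degree four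
-- lies in a K₄ whose other vertices have degree at least five, and discharging shows that the
-- average degree is at least 22/5.
module Submission where

open import Defs
open import Data.Nat using (ℕ; _+_; _*_; _<_)
open import Data.Fin.Subset using (Subset)
open import Data.Product using (∃-syntax)

open import Algebra.Properties.Semiring.Sum using (*-distribˡ-sum; *-distribʳ-sum)
open import Data.Bool using (if_then_else_; _∧_; T)
open import Data.Bool.Properties using (T?)
open import Data.Empty using (⊥; ⊥-elim)
open import Data.Fin using (Fin; zero; suc; toℕ)
open import Data.Fin.Properties using (_≟_; any?; toℕ-injective)
open import Data.Fin.Subset using (_∉_) renaming (_∈_ to _∈ₛ_)
open import Data.List using (List; []; _∷_; length; allFin; filter; last)
import Data.List as List
open import Data.List.Membership.Propositional using (_∈_)
open import Data.List.Membership.Propositional.Properties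
  using (∈-++⁺ˡ; ∈-++⁺ʳ; ∈-filter⁺; ∈-filter⁻; ∈-allFin)
import Data.List.Membership.DecPropositional as DecMembership
open import Data.List.Properties using (map-tabulate; length-++)
open import Data.List.Relation.Binary.Permutation.Propositional
  using (_↭_; ↭⇒↭ₛ; ↭-sym; ↭-refl; ↭-prep; ↭-swap; ↭-trans)
open import Data.List.Relation.Binary.Permutation.Propositional.Properties using (∈-resp-↭; All-resp-↭; ∷↭∷ʳ)
import Data.List.Relation.Binary.Permutation.Setoid.Properties as SetoidPermutation
open import Data.List.Relation.Unary.All as All using (All; []; _∷_)
open import Data.List.Relation.Unary.AllPairs using (AllPairs; []; _∷_)
open import Data.List.Relation.Unary.Any using (here; there)
open import Data.List.Relation.Unary.Linked using (Linked; _∷_)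
open import Data.List.Relation.Unary.Unique.Propositional using (Unique)
open import Data.List.Relation.Unary.Unique.Propositional.Properties using (allFin⁺; filter⁺)
open import Data.Maybe using (just)
open import Data.Nat using (zero; suc; _≤_; z≤n; s≤s; _≤?_)
import Data.Nat.ListAction as ListAction
open import Data.Nat.Induction using (<-rec)
open import Data.Nat.Properties renaming (_≟_ to _≟ⁿ_)
open import Data.Nat.Solver using (module +-*-Solver)
open import Data.Product using (∃; _×_; _,_; proj₁; proj₂)
open import Data.Sum using (_⊎_; inj₁; inj₂; [_,_]; map₂)
open import Data.Unit using (⊤; tt)
import Data.Vec as Vec
open import Data.Vec.Properties using (lookup∘tabulate; []=⇒lookup; lookup⇒[]=)
open import Function using (_∘_; id; case_of_)
open import Relation.Binary.PropositionalEquality hiding ([_])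
open import Relation.Nullary using (¬_; Dec; yes; no; does; contradiction)
open import Relation.Nullary.Decidable using (_×-dec_; _⊎-dec_; _→-dec_; ¬?; map′; ⌊_⌋)
open import Relation.Unary using (Decidable)

open import Algebra.Properties.CommutativeMonoid.Sum +-0-commutativeMonoid
  using (sum; sum-cong-≗; sum-replicate-zero; ∑-distrib-+; ∑-comm)

-- Counting

𝟙 : ∀ {P : Set} → Dec P → ℕ
𝟙 d = if does d then 1 else 0

count : ∀ {n} {P : Fin n → Set} → Decidable P → ℕ
count P? = sum (λ x → 𝟙 (P? x))

sum-mono : ∀ {n} {f g : Fin n → ℕ} → (∀ x → f x ≤ g x) → sum f ≤ sum g
sum-mono {zero}  f≤g = z≤n
sum-mono {suc n} f≤g = +-mono-≤ (f≤g zero) (sum-mono (f≤g ∘ suc))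

𝟙-yes : ∀ {P : Set} (p? : Dec P) → P → 𝟙 p? ≡ 1
𝟙-yes (yes _) _ = refl
𝟙-yes (no ¬p) p = contradiction p ¬p

𝟙-mono : ∀ {P Q : Set} (p? : Dec P) (q? : Dec Q) → (P → Q) → 𝟙 p? ≤ 𝟙 q?
𝟙-mono (yes p) (yes q) _   = ≤-refl
𝟙-mono (yes p) (no ¬q) p⇒q = contradiction (p⇒q p) ¬q
𝟙-mono (no _)  _       _   = z≤n

𝟙-union : ∀ {P Q R : Set} (p? : Dec P) (q? : Dec Q) (r? : Dec R) →
          (P → Q ⊎ R) → 𝟙 p? ≤ 𝟙 q? + 𝟙 r?
𝟙-union (no _)  _       _       _ = z≤n
𝟙-union (yes p) (yes _) _       _ = s≤s z≤n
𝟙-union (yes p) (no _)  (yes _) _ = ≤-refl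
𝟙-union (yes p) (no ¬q) (no ¬r) f = ⊥-elim ([ ¬q , ¬r ] (f p))

𝟙-disjoint : ∀ {P Q R : Set} (p? : Dec P) (q? : Dec Q) (r? : Dec R) →
             (Q → P) → (R → P) → (Q → R → ⊥) → 𝟙 q? + 𝟙 r? ≤ 𝟙 p?
𝟙-disjoint p? (yes q) (yes r) _   _   q⊥r = ⊥-elim (q⊥r q r)
𝟙-disjoint p? (yes q) (no _)  q⇒p _   _   = ≤-reflexive (sym (𝟙-yes p? (q⇒p q)))
𝟙-disjoint p? (no _)  r?      _   r⇒p _   = 𝟙-mono r? p? r⇒p

module _ {n : ℕ} {P Q : Fin n → Set} (P? : Decidable P) (Q? : Decidable Q) where

  count-mono : (∀ x → P x → Q x) → count P? ≤ count Q?
  count-mono P⊆Q = sum-mono (λ x → 𝟙-mono (P? x) (Q? x) (P⊆Q x))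

  count-union : ∀ {R : Fin n → Set} (R? : Decidable R) →
                (∀ x → P x → Q x ⊎ R x) → count P? ≤ count Q? + count R?
  count-union R? P⊆Q∪R = ≤-trans (sum-mono (λ x → 𝟙-union (P? x) (Q? x) (R? x) (P⊆Q∪R x)))
                                 (≤-reflexive (∑-distrib-+ (λ x → 𝟙 (Q? x)) (λ x → 𝟙 (R? x))))

  count-disjoint : ∀ {R : Fin n → Set} (R? : Decidable R) → (∀ x → Q x → P x) →
                   (∀ x → R x → P x) → (∀ x → Q x → R x → ⊥) → count Q? + count R? ≤ count P?
  count-disjoint R? Q⊆P R⊆P Q⊥R =
    ≤-trans (≤-reflexive (sym (∑-distrib-+ (λ x → 𝟙 (Q? x)) (λ x → 𝟙 (R? x)))))
            (sum-mono (λ x → 𝟙-disjoint (P? x) (Q? x) (R? x) (Q⊆P x) (R⊆P x) (Q⊥R x)))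

count-empty : ∀ {n} {P : Fin n → Set} (P? : Decidable P) → (∀ x → ¬ P x) → count P? ≡ 0
count-empty {n} P? ¬P = trans (sum-cong-≗ zero-entry) (sum-replicate-zero n)
  where
  zero-entry : ∀ x → 𝟙 (P? x) ≡ 0
  zero-entry x with P? x
  ... | yes p = contradiction p (¬P x)
  ... | no _  = refl

count-singleton : ∀ {n} (u : Fin n) → count (_≟ u) ≡ 1
count-singleton {suc n} zero    = cong suc (count-empty {n} (λ x → suc x ≟ zero) (λ _ ()))
count-singleton {suc n} (suc u) = trans (sum-cong-≗ same) (count-singleton u)
  where
  same : ∀ x → 𝟙 (suc x ≟ suc u) ≡ 𝟙 (x ≟ u)
  same x with x ≟ u
  ... | yes _ = refl
  ... | no _  = refl

module _ {n : ℕ} where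
  open DecMembership (_≟_ {n}) using (_∈?_)
  open SetoidPermutation (setoid (Fin n)) using (Unique-resp-↭)

  count-list : ∀ (xs : List (Fin n)) → count (_∈? xs) ≤ length xs
  count-list []       = ≤-reflexive (count-empty (_∈? []) (λ _ ()))
  count-list (x ∷ xs) = ≤-trans
    (count-union (_∈? (x ∷ xs)) (_≟ x) (_∈? xs) (λ { _ (here eq) → inj₁ eq ; _ (there p) → inj₂ p }))
    (+-mono-≤ (≤-reflexive (count-singleton x)) (count-list xs))

  count-unique : ∀ {xs : List (Fin n)} → Unique xs → length xs ≤ count (_∈? xs)
  count-unique {[]}     _            = z≤n
  count-unique {x ∷ xs} (x∉xs ∷ uxs) = ≤-trans
    (+-mono-≤ (≤-reflexive (sym (count-singleton x))) (count-unique uxs))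
    (count-disjoint (_∈? (x ∷ xs)) (_≟ x) (_∈? xs) (λ { _ refl → here refl }) (λ _ → there)
      (λ { _ refl p → All.lookup x∉xs p refl }))

  exists-outside : ∀ {P : Fin n → Set} (P? : Decidable P) (xs : List (Fin n)) →
                   length xs < count P? → ∃[ y ] (P y × ¬ (y ∈ xs))
  exists-outside P? xs short with any? (λ y → P? y ×-dec ¬? (y ∈? xs))
  ... | yes found = found
  ... | no ¬found = contradiction short (≤⇒≯ (≤-trans (count-mono P? (_∈? xs) covered) (count-list xs)))
    where
    covered : ∀ y → _ → y ∈ xs
    covered y py with y ∈? xs
    ... | yes p = p
    ... | no ¬p = contradiction (y , py , ¬p) ¬found

  length≤count : ∀ {P : Fin n → Set} (P? : Decidable P) {xs} → Unique xs → All P xs →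
                 length xs ≤ count P?
  length≤count P? {xs} uxs pxs = ≤-trans (count-unique uxs) (count-mono (_∈? xs) P? (λ _ → All.lookup pxs))

  -- Gives names to the neighbours of a vertex; `permute` then moves a configuration into standard
  -- position, in place of an argument without loss of generality.
  record Enumeration (P : Fin n → Set) (xs : List (Fin n)) : Set where
    constructor enumeration
    field
      unique   : Unique xs
      sound    : All P xs
      complete : ∀ {y} → P y → y ∈ xs

  permute : ∀ {P : Fin n → Set} {xs ys} → xs ↭ ys → Enumeration P xs → Enumeration P ys
  permute p (enumeration u s c) =
    enumeration (Unique-resp-↭ (↭⇒↭ₛ p) u) (All-resp-↭ p s) (λ py → ∈-resp-↭ p (c py))

  enumerate : ∀ {P : Fin n → Set} (P? : Decidable P) →
              ∃[ xs ] (Enumeration P xs × length xs ≡ count P?)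
  enumerate {P} P? = xs , e , ≤-antisym
      (length≤count P? (Enumeration.unique e) (Enumeration.sound e))
      (≤-trans (count-mono P? (_∈? xs) (λ _ → Enumeration.complete e)) (count-list xs))
    where
    xs = filter P? (allFin n)
    e : Enumeration P xs
    e = enumeration (filter⁺ P? (allFin⁺ n))
                    (All.tabulate (λ p → proj₂ (∈-filter⁻ P? {xs = allFin n} p)))
                    (λ {y} → ∈-filter⁺ P? (∈-allFin y))

-- Graphs on a subset of the vertices

-- The vertices form a decidable subset of a fixed `Fin N`, so deleting a vertex relabels nothing
-- and a cut of a smaller graph colours the same indices. Indices outside the subset have degree
-- zero by `edge-vertex`.
record PartialGraph (N : ℕ) : Set₁ where
  field
    Vertex      : Fin N → Set
    vertex?     : Decidable Vertex
    Edge        : Fin N → Fin N → Set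
    edge?       : ∀ x y → Dec (Edge x y)
    edge-sym    : ∀ {x y} → Edge x y → Edge y x
    edge-irrefl : ∀ {x} → ¬ Edge x x
    edge-vertex : ∀ {x y} → Edge x y → Vertex x

  deg : Fin N → ℕ
  deg x = count (edge? x)

  size degreeSum : ℕ
  size      = count vertex?
  degreeSum = sum deg

  -- Twice the inequality 5 |E| + 18 < 11 |V|.
  Sparse : Set
  Sparse = 5 * degreeSum + 36 < 22 * size

  edge⇒≢ : ∀ {x y} → Edge x y → x ≢ y
  edge⇒≢ e refl = edge-irrefl e

module _ {N : ℕ} where

  delete : PartialGraph N → Fin N → PartialGraph N
  delete G u = record
    { Vertex      = λ x → Vertex x × x ≢ u
    ; vertex?     = λ x → vertex? x ×-dec ¬? (x ≟ u)
    ; Edge        = λ x y → Edge x y × x ≢ u × y ≢ u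
    ; edge?       = λ x y → edge? x y ×-dec ¬? (x ≟ u) ×-dec ¬? (y ≟ u)
    ; edge-sym    = λ (e , x≢u , y≢u) → edge-sym e , y≢u , x≢u
    ; edge-irrefl = λ (e , _) → edge-irrefl e
    ; edge-vertex = λ (e , x≢u , _) → edge-vertex e , x≢u
    } where open PartialGraph G

  join : (G : PartialGraph N) (a b : Fin N) → PartialGraph.Vertex G a → PartialGraph.Vertex G b →
         a ≢ b → PartialGraph N
  join G a b va vb a≢b = record
    { Vertex      = Vertex
    ; vertex?     = vertex?
    ; Edge        = λ x y → Edge x y ⊎ (x ≡ a × y ≡ b ⊎ x ≡ b × y ≡ a)
    ; edge?       = λ x y → edge? x y ⊎-dec ((x ≟ a ×-dec y ≟ b) ⊎-dec (x ≟ b ×-dec y ≟ a))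
    ; edge-sym    = λ { (inj₁ e) → inj₁ (edge-sym e)
                      ; (inj₂ (inj₁ (p , q))) → inj₂ (inj₂ (q , p))
                      ; (inj₂ (inj₂ (p , q))) → inj₂ (inj₁ (q , p)) }
    ; edge-irrefl = λ { (inj₁ e) → edge-irrefl e
                      ; (inj₂ (inj₁ (refl , q))) → a≢b q
                      ; (inj₂ (inj₂ (refl , q))) → a≢b (sym q) }
    ; edge-vertex = λ { (inj₁ e) → edge-vertex e
                      ; (inj₂ (inj₁ (refl , _))) → va
                      ; (inj₂ (inj₂ (refl , _))) → vb }
    } where open PartialGraph G

  module _ (G : PartialGraph N) (u : Fin N) where
    open PartialGraph G
    private module G′ = PartialGraph (delete G u)

    size≤size-delete+1 : size ≤ G′.size + 1
    size≤size-delete+1 = ≤-trans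
      (count-union vertex? G′.vertex? (_≟ u) split)
      (≤-reflexive (cong (G′.size +_) (count-singleton u)))
      where
      split : ∀ x → Vertex x → (Vertex x × x ≢ u) ⊎ x ≡ u
      split x vx with x ≟ u
      ... | yes x≡u = inj₂ x≡u
      ... | no x≢u  = inj₁ (vx , x≢u)

    size-delete<size : Vertex u → G′.size < size
    size-delete<size vu = ≤-trans
      (≤-reflexive (cong (_+ G′.size) (sym (count-singleton u))))
      (count-disjoint vertex? (_≟ u) G′.vertex? (λ { _ refl → vu }) (λ _ → proj₁)
        (λ _ x≡u (_ , x≢u) → x≢u x≡u))

    deg≤deg-delete+1 : ∀ {x} → x ≢ u → deg x ≤ G′.deg x + 1
    deg≤deg-delete+1 {x} x≢u = ≤-trans
      (count-union (edge? x) (G′.edge? x) (_≟ u) split)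
      (≤-reflexive (cong (G′.deg x +_) (count-singleton u)))
      where
      split : ∀ y → Edge x y → (Edge x y × x ≢ u × y ≢ u) ⊎ y ≡ u
      split y e with y ≟ u
      ... | yes y≡u = inj₂ y≡u
      ... | no y≢u  = inj₁ (e , x≢u , y≢u)

    -- In the adjacency matrix, deletion clears the row and the column of `u`, each of sum `deg u`.
    -- The inequality is checked row by row.
    degreeSum-delete : G′.degreeSum + 2 * deg u ≤ degreeSum
    degreeSum-delete = begin
      G′.degreeSum + 2 * deg u
        ≡⟨ solve 2 (λ s d → s :+ con 2 :* d := (s :+ con 1 :* d) :+ d) refl G′.degreeSum (deg u) ⟩
      (G′.degreeSum + 1 * deg u) + deg u
        ≤⟨ +-mono-≤ (+-monoʳ-≤ G′.degreeSum (≤-reflexive diagonal))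
                    (count-mono (edge? u) (λ x → edge? x u) (λ _ → edge-sym)) ⟩
      (G′.degreeSum + sum (λ x → 𝟙 (x ≟ u) * deg u)) + sum (λ x → 𝟙 (edge? x u))
        ≡⟨ cong (_+ sum (λ x → 𝟙 (edge? x u))) (∑-distrib-+ G′.deg (λ x → 𝟙 (x ≟ u) * deg u)) ⟨
      sum (λ x → G′.deg x + 𝟙 (x ≟ u) * deg u) + sum (λ x → 𝟙 (edge? x u))
        ≡⟨ ∑-distrib-+ (λ x → G′.deg x + 𝟙 (x ≟ u) * deg u) (λ x → 𝟙 (edge? x u)) ⟨
      sum (λ x → (G′.deg x + 𝟙 (x ≟ u) * deg u) + 𝟙 (edge? x u))
        ≤⟨ sum-mono (λ x → row x (x ≟ u) (edge? x u)) ⟩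
      degreeSum ∎
      where
      open ≤-Reasoning
      open +-*-Solver
      diagonal : 1 * deg u ≡ sum (λ x → 𝟙 (x ≟ u) * deg u)
      diagonal = trans (cong (_* deg u) (sym (count-singleton u)))
                       (*-distribʳ-sum +-*-semiring (deg u) (λ x → 𝟙 (x ≟ u)))
      row : ∀ x (d : Dec (x ≡ u)) (e : Dec (Edge x u)) → (G′.deg x + 𝟙 d * deg u) + 𝟙 e ≤ deg x
      row x (yes refl) (yes e) = ⊥-elim (edge-irrefl e)
      row x (yes refl) (no _) = ≤-reflexive (trans (+-identityʳ _) (trans
            (cong (_+ 1 * deg x) (count-empty (G′.edge? x) (λ _ (_ , x≢x , _) → x≢x refl)))
            (*-identityˡ (deg x))))
      row x (no _) (no _) = ≤-trans (≤-reflexive (trans (+-identityʳ _) (+-identityʳ _)))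
            (count-mono (G′.edge? x) (edge? x) (λ _ → proj₁))
      row x (no _) (yes e) = ≤-trans
            (≤-reflexive (cong₂ _+_ (+-identityʳ (G′.deg x)) (sym (count-singleton u))))
            (count-disjoint (edge? x) (G′.edge? x) (_≟ u) (λ _ → proj₁) (λ { _ refl → e })
              (λ _ (_ , _ , y≢u) → y≢u))

  -- An inequality, because `a` and `b` may already be adjacent in `G`.
  degreeSum-join : ∀ (G : PartialGraph N) {a b} va vb a≢b →
    PartialGraph.degreeSum (join G a b va vb a≢b) ≤ PartialGraph.degreeSum G + 2
  degreeSum-join G {a} {b} va vb a≢b = begin
    sum G⁺.deg
      ≤⟨ sum-mono row ⟩
    sum (λ x → deg x + (𝟙 (x ≟ a) + 𝟙 (x ≟ b)))
      ≡⟨ ∑-distrib-+ deg (λ x → 𝟙 (x ≟ a) + 𝟙 (x ≟ b)) ⟩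
    degreeSum + sum (λ x → 𝟙 (x ≟ a) + 𝟙 (x ≟ b))
      ≡⟨ cong (degreeSum +_) (∑-distrib-+ (λ x → 𝟙 (x ≟ a)) (λ x → 𝟙 (x ≟ b))) ⟩
    degreeSum + (count (_≟ a) + count (_≟ b))
      ≡⟨ cong (degreeSum +_) (cong₂ _+_ (count-singleton a) (count-singleton b)) ⟩
    degreeSum + 2 ∎
    where
    open ≤-Reasoning
    open PartialGraph G
    module G⁺ = PartialGraph (join G a b va vb a≢b)
    conditional : ∀ {P : Set} (p? : Dec P) (z : Fin N) → count (λ y → p? ×-dec y ≟ z) ≤ 𝟙 p?
    conditional (yes p) z = ≤-trans (count-mono (λ y → yes p ×-dec y ≟ z) (_≟ z) (λ _ → proj₂))
                                    (≤-reflexive (count-singleton z))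
    conditional (no ¬p) z = ≤-reflexive (count-empty (λ y → no ¬p ×-dec y ≟ z) (λ _ (p , _) → ¬p p))
    row : ∀ x → G⁺.deg x ≤ deg x + (𝟙 (x ≟ a) + 𝟙 (x ≟ b))
    row x = ≤-trans
      (count-union (G⁺.edge? x) (edge? x) (λ y → (x ≟ a ×-dec y ≟ b) ⊎-dec (x ≟ b ×-dec y ≟ a)) (λ _ → id))
      (+-monoʳ-≤ (deg x) (≤-trans
        (count-union (λ y → (x ≟ a ×-dec y ≟ b) ⊎-dec (x ≟ b ×-dec y ≟ a))
                     (λ y → x ≟ a ×-dec y ≟ b) (λ y → x ≟ b ×-dec y ≟ a) (λ _ → id))
        (+-mono-≤ (conditional (x ≟ a) b) (conditional (x ≟ b) a))))

  -- Losing e in the degree sum and at most k vertices keeps the bound as soon as 22 k ≤ 5 e.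
  sparse-descend : ∀ (G G′ : PartialGraph N) {e k} →
    PartialGraph.degreeSum G′ + e ≤ PartialGraph.degreeSum G →
    PartialGraph.size G ≤ PartialGraph.size G′ + k → 22 * k ≤ 5 * e →
    PartialGraph.Sparse G → PartialGraph.Sparse G′
  sparse-descend G G′ {e} {k} edges vertices gain sparse =
    +-cancelʳ-< (22 * k) _ _ (begin-strict
      5 * D′ + 36 + 22 * k   ≤⟨ +-monoʳ-≤ (5 * D′ + 36) gain ⟩
      5 * D′ + 36 + 5 * e    ≡⟨ solve 2 (λ d e → con 5 :* d :+ con 36 :+ con 5 :* e
                                            := con 5 :* (d :+ e) :+ con 36) refl D′ e ⟩
      5 * (D′ + e) + 36      ≤⟨ +-monoˡ-≤ 36 (*-monoʳ-≤ 5 edges) ⟩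
      5 * degreeSum G + 36   <⟨ sparse ⟩
      22 * size G            ≤⟨ *-monoʳ-≤ 22 vertices ⟩
      22 * (size G′ + k)     ≡⟨ *-distribˡ-+ 22 (size G′) k ⟩
      22 * size G′ + 22 * k  ∎)
    where
    open ≤-Reasoning
    open +-*-Solver
    open PartialGraph
    D′ = degreeSum G′

-- Cuts

data Side : Set where
  left right cut : Side

_≟ˢ_ : (s t : Side) → Dec (s ≡ t)
left  ≟ˢ left  = yes refl
left  ≟ˢ right = no λ ()
left  ≟ˢ cut   = no λ ()
right ≟ˢ left  = no λ ()
right ≟ˢ right = yes refl
right ≟ˢ cut   = no λ ()
cut   ≟ˢ left  = no λ ()
cut   ≟ˢ right = no λ ()
cut   ≟ˢ cut   = yes refl

module _ {N : ℕ} (G : PartialGraph N) where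
  open PartialGraph G
  open DecMembership (_≟_ {N}) using (_∈?_)

  -- A finite graph is a forest iff it has no nonempty vertex set inducing minimum degree at
  -- least two; in this form acyclicity is preserved by passing to subgraphs without handling cycles.
  record Core (T : Fin N → Set) : Set where
    field
      inhabited : ∃ T
      branching : ∀ {x} → T x → ∃[ y ] ∃[ z ] (y ≢ z × (T y × Edge x y) × (T z × Edge x z))

  -- The colouring `side` covers every index of `Fin N`; the witnesses `on-left` and `on-right` must
  -- be actual vertices. Forests are expressed by the absence of a `Core` among the indices coloured
  -- `cut`.
  record Cut : Set₁ where
    field
      side      : Fin N → Side
      separated : ∀ {x y} → Edge x y → side x ≡ left → side y ≡ right → ⊥
      on-left   : ∃[ x ] (Vertex x × side x ≡ left)
      on-right  : ∃[ x ] (Vertex x × side x ≡ right)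
      forest    : ∀ {T} → Core T → (∀ {x} → T x → side x ≡ cut) → ⊥

  Leaf : Fin N → List (Fin N) → Set
  Leaf x xs = ∀ {y z} → y ∈ xs → z ∈ xs → Edge x y → Edge x z → y ≡ z

  leaf? : ∀ x xs → Dec (Leaf x xs)
  leaf? x xs = map′ (λ h p q e f → All.lookup (All.lookup h p) q e f)
                    (λ h → All.tabulate (λ p → All.tabulate (λ q → h p q)))
    (All.all? (λ y → All.all? (λ z → edge? x y →-dec (edge? x z →-dec y ≟ z)) xs) xs)

  infixr 5 _∷_
  -- A 1-degenerate ordering, the certificate for a forest: each vertex is removed when at most one
  -- neighbour remains in the list.
  data Eliminable : List (Fin N) → Set where
    []  : Eliminable []
    _∷_ : ∀ {x xs} → Leaf x xs → Eliminable xs → Eliminable (x ∷ xs)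

  leaf-[] : ∀ {x} → Leaf x []
  leaf-[] ()

  leaf-[-] : ∀ {x y} → Leaf x (y ∷ [])
  leaf-[-] (here refl) (here refl) _ _ = refl

  leaf-pair : ∀ {x y z} → ¬ (Edge x y × Edge x z) → Leaf x (y ∷ z ∷ [])
  leaf-pair h (here refl)         (here refl)         _ _ = refl
  leaf-pair h (here refl)         (there (here refl)) e f = contradiction (e , f) h
  leaf-pair h (there (here refl)) (here refl)         e f = contradiction (f , e) h
  leaf-pair h (there (here refl)) (there (here refl)) _ _ = refl

  leaf-skip : ∀ {x y ys} → ¬ Edge x y → Leaf x ys → Leaf x (y ∷ ys)
  leaf-skip h l (here refl) _           e _ = contradiction e h
  leaf-skip h l (there p)   (here refl) _ f = contradiction f h
  leaf-skip h l (there p)   (there q)   e f = l p q e f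

  -- The head of the list has at most one neighbour in the tail, but a member of a core has two
  -- inside the core. So the core avoids the head and lies in the tail.
  eliminable⇒no-core : ∀ {xs T} → Eliminable xs → Core T → (∀ {x} → T x → x ∈ xs) → ⊥
  eliminable⇒no-core []       core T⊆ with T⊆ (proj₂ (Core.inhabited core))
  ... | ()
  eliminable⇒no-core {x ∷ xs} {T} (leaf ∷ elim) core T⊆ =
    eliminable⇒no-core elim core (λ {y} ty → tail ty (T⊆ ty))
    where
    ¬Tx : ¬ T x
    ¬Tx tx with Core.branching core tx
    ... | y , z , y≢z , (ty , e) , (tz , f) with T⊆ ty | T⊆ tz
    ... | here refl | _         = edge-irrefl e
    ... | there p   | here refl = edge-irrefl f
    ... | there p   | there q   = y≢z (leaf p q e f)
    tail : ∀ {y} → T y → y ∈ x ∷ xs → y ∈ xs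
    tail ty (here refl) = contradiction ty ¬Tx
    tail ty (there p)   = p

  -- `X` becomes the left side, `C` the cut and everything else the right side, which contains a
  -- vertex by counting.
  cut-around : ∀ (X C : List (Fin N)) {x} → x ∈ X → Vertex x →
    (∀ {x y} → x ∈ X → Edge x y → y ∈ X ⊎ y ∈ C) → Eliminable C →
    length X + length C < size → Cut
  cut-around X C {x₀} x₀∈X vx₀ closed elim small = record
    { side      = λ x → side (x ∈? X) (x ∈? C)
    ; separated = λ {x} {y} → separated (x ∈? X) (x ∈? C) (y ∈? X) (y ∈? C)
    ; on-left   = x₀ , vx₀ , is-left (x₀ ∈? X)
    ; on-right  = proj₁ outside , proj₁ (proj₂ outside) , is-right (proj₁ outside ∈? X) (proj₁ outside ∈? C)
    ; forest    = λ core T⊆ → eliminable⇒no-core elim core (λ {x} tx → in-cut (x ∈? X) (x ∈? C) (T⊆ tx))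
    }
    where
    side : ∀ {P Q : Set} → Dec P → Dec Q → Side
    side (yes _) _       = left
    side (no _)  (yes _) = cut
    side (no _)  (no _)  = right
    outside : ∃[ y ] (Vertex y × ¬ (y ∈ X List.++ C))
    outside = exists-outside vertex? (X List.++ C) (subst (_< size) (sym (length-++ X)) small)
    is-left : ∀ {Q : Set} {q : Dec Q} (d : Dec (x₀ ∈ X)) → side d q ≡ left
    is-left (yes _) = refl
    is-left (no ¬p) = contradiction x₀∈X ¬p
    is-right : (d : Dec (proj₁ outside ∈ X)) (e : Dec (proj₁ outside ∈ C)) → side d e ≡ right
    is-right (yes p) _       = contradiction (∈-++⁺ˡ p) (proj₂ (proj₂ outside))
    is-right (no _)  (yes p) = contradiction (∈-++⁺ʳ X p) (proj₂ (proj₂ outside))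
    is-right (no _)  (no _)  = refl
    in-cut : ∀ {P Q : Set} (d : Dec P) (e : Dec Q) → side d e ≡ cut → Q
    in-cut (no _) (yes q) _ = q
    separated : ∀ {x y} (d : Dec (x ∈ X)) (d′ : Dec (x ∈ C)) (e : Dec (y ∈ X)) (e′ : Dec (y ∈ C)) →
                Edge x y → side d d′ ≡ left → side e e′ ≡ right → ⊥
    separated (yes p) _ (no ¬q) (no ¬r) xy _ _ = [ ¬q , ¬r ] (closed p xy)
    separated (no _) (yes _) _ _ _ () _
    separated (no _) (no _)  _ _ _ () _

-- A cut of a smaller graph G′ extends to G when the neighbourhood of the deleted set X does not
-- meet both sides: X joins the side that its neighbourhood meets.
module _ {N : ℕ} (G G′ : PartialGraph N) {X : Fin N → Set} (X? : Decidable X) where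
  open PartialGraph G
  private module G′ = PartialGraph G′

  Boundary : Fin N → Set
  Boundary p = ¬ X p × ∃[ x ] (X x × Edge x p)

  extend : (∀ {x} → G′.Vertex x → Vertex x × ¬ X x) →
           (∀ {x y} → ¬ X x → ¬ X y → Edge x y → G′.Edge x y) →
           (c : Cut G′) →
           (∀ {p q} → Boundary p → Boundary q → Cut.side c p ≡ left → Cut.side c q ≡ right → ⊥) →
           Cut G
  extend vertex⊆ edge⊆ c mono = record
    { side      = λ x → side x (X? x)
    ; separated = λ {x} {y} → separated (X? x) (X? y)
    ; on-left   = let x , v , s = C.on-left in x , proj₁ (vertex⊆ v) , trans (off (X? x) (proj₂ (vertex⊆ v))) s
    ; on-right  = let x , v , s = C.on-right in x , proj₁ (vertex⊆ v) , trans (off (X? x) (proj₂ (vertex⊆ v))) s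
    ; forest    = λ core T⊆ → C.forest (restrict core T⊆) (λ {x} tx → proj₂ (cut-off (X? x) (T⊆ tx)))
    }
    where
    module C = Cut c
    meets-right? : Dec (∃[ p ] (C.side p ≡ right × Boundary p))
    meets-right? = any? λ p → C.side p ≟ˢ right ×-dec
                     ¬? (X? p) ×-dec any? λ x → X? x ×-dec edge? x p
    -- If the boundary of `X` lies entirely in the cut, `X` goes to the left by default.
    sideX : ∀ {P : Set} → Dec P → Side
    sideX (yes _) = right
    sideX (no _)  = left
    side : ∀ x → Dec (X x) → Side
    side x (yes _) = sideX meets-right?
    side x (no _)  = C.side x
    off : ∀ {x} (d : Dec (X x)) → ¬ X x → side x d ≡ C.side x
    off (yes p) ¬p = contradiction p ¬p
    off (no _)  _  = refl
    sideX≢cut : ∀ {P : Set} (d : Dec P) → sideX d ≢ cut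
    sideX≢cut (yes _) ()
    sideX≢cut (no _)  ()
    cut-off : ∀ {x} (d : Dec (X x)) → side x d ≡ cut → ¬ X x × C.side x ≡ cut
    cut-off (yes _) s = contradiction s (sideX≢cut meets-right?)
    cut-off (no ¬p) s = ¬p , s
    -- `X` is never coloured `cut`, so every edge inside the cut survives in `G′`.
    restrict : ∀ {T} → Core G T → (∀ {x} → T x → side x (X? x) ≡ cut) → Core G′ T
    restrict {T} core T⊆ = record
      { inhabited = Core.inhabited core
      ; branching = λ tx → let y , z , y≢z , (ty , e) , (tz , f) = Core.branching core tx in
          y , z , y≢z , (ty , edge⊆ (off-X tx) (off-X ty) e) , (tz , edge⊆ (off-X tx) (off-X tz) f)
      }
      where
      off-X : ∀ {x} → T x → ¬ X x
      off-X {x} tx = proj₁ (cut-off (X? x) (T⊆ tx))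
    left-side : ∀ (d : Dec (∃[ p ] (C.side p ≡ right × Boundary p))) → sideX d ≡ left →
                ∀ {p} → C.side p ≡ right → Boundary p → ⊥
    left-side (no ¬p) _ s b = ¬p (_ , s , b)
    right-side : ∀ (d : Dec (∃[ p ] (C.side p ≡ right × Boundary p))) → sideX d ≡ right →
                 ∃[ p ] (C.side p ≡ right × Boundary p)
    right-side (yes p) _ = p
    separated : ∀ {x y} (d : Dec (X x)) (d′ : Dec (X y)) → Edge x y →
                side x d ≡ left → side y d′ ≡ right → ⊥
    separated (yes _) (yes _)  e l r = case trans (sym l) r of λ ()
    separated (yes p) (no ¬q)  e l r = left-side meets-right? l r (¬q , _ , p , e)
    separated (no ¬p) (no ¬q)  e l r = C.separated (edge⊆ ¬p ¬q e) l r
    -- `X` is on the right only because some boundary vertex `z` is; together with the left vertex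
    -- met here, `z` contradicts `mono`.
    separated (no ¬p) (yes q)  e l r =
      let z , s , b = right-side meets-right? r in mono (¬p , _ , q , edge-sym e) b l s

-- Reducible configurations

three : ∀ {A : Set} (xs : List A) → length xs ≡ 3 → ∃[ a ] ∃[ b ] ∃[ c ] xs ≡ a ∷ b ∷ c ∷ []
three (a ∷ b ∷ c ∷ []) refl = a , b , c , refl

four : ∀ {A : Set} (xs : List A) → length xs ≡ 4 → ∃[ a ] ∃[ b ] ∃[ c ] ∃[ d ] xs ≡ a ∷ b ∷ c ∷ d ∷ []
four (a ∷ b ∷ c ∷ d ∷ []) refl = a , b , c , d , refl

pairwise : ∀ {A : Set} {R : A → A → Set} {xs} → (∀ {x y} → R x y → R y x) → AllPairs R xs →
           ∀ {p q} → p ∈ xs → q ∈ xs → p ≡ q ⊎ R p q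
pairwise R-sym (r ∷ rs) (here refl) (here refl) = inj₁ refl
pairwise R-sym (r ∷ rs) (here refl) (there q)   = inj₂ (All.lookup r q)
pairwise R-sym (r ∷ rs) (there p)   (here refl) = inj₂ (R-sym (All.lookup r p))
pairwise R-sym (r ∷ rs) (there p)   (there q)   = pairwise R-sym rs p q

choose-all : ∀ {n} {C : Set₁} {P : Fin n → Set} → (∀ i → C ⊎ P i) → C ⊎ (∀ i → P i)
choose-all {zero}  f = inj₂ λ ()
choose-all {suc n} f with f zero | choose-all (f ∘ suc)
... | inj₁ c | _      = inj₁ c
... | inj₂ _ | inj₁ c = inj₁ c
... | inj₂ p | inj₂ q = inj₂ λ { zero → p ; (suc i) → q i }

-- One step of the induction, with `smaller` as the induction hypothesis.
module Reduction {N : ℕ} (G : PartialGraph N) (sparse : PartialGraph.Sparse G)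
  (smaller : ∀ (G′ : PartialGraph N) → PartialGraph.size G′ < PartialGraph.size G → PartialGraph.Sparse G′ → Cut G′)
  where
  open PartialGraph G

  Neighbours : Fin N → List (Fin N) → Set
  Neighbours u = Enumeration (Edge u)

  cut-at : ∀ {u xs} → Vertex u → (∀ {y} → Edge u y → y ∈ xs) → Eliminable G xs →
           suc (length xs) < size → Cut G
  cut-at {u} {xs} vu nbrs = cut-around G (u ∷ []) xs (here refl) vu (λ { (here refl) e → inj₂ (nbrs e) })

  abstract
    delete-one : ∀ {u} → Vertex u → 3 ≤ deg u → Cut (delete G u)
    delete-one {u} vu 3≤deg = smaller (delete G u) (size-delete<size G u vu)
      -- Three lost edges lower the degree sum by `6`, and `22 ≤ 5 * 6`.
      (sparse-descend G (delete G u) {2 * 3} {1}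
        (≤-trans (+-monoʳ-≤ _ (*-monoʳ-≤ 2 3≤deg)) (degreeSum-delete G u))
        (size≤size-delete+1 G u) (m≤m+n 22 8) sparse)

  -- The neighbourhood of `u` is a clique, so no cut of the graph without `u` has neighbours of `u`
  -- on both sides.
  reduce-triangle : ∀ {u a b c} → Vertex u → deg u ≡ 3 → Neighbours u (a ∷ b ∷ c ∷ []) →
                    Edge a b → Edge a c → Edge b c → Cut G
  reduce-triangle {u} {a} {b} {c} vu deg≡3 nbrs ab ac bc =
    extend G (delete G u) (_≟ u) id (λ x≢u y≢u e → e , x≢u , y≢u) C mono
    where
    C = delete-one vu (≤-reflexive (sym deg≡3))
    open Cut C
    mono : ∀ {p q} → Boundary G (delete G u) (_≟ u) p → Boundary G (delete G u) (_≟ u) q →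
           side p ≡ left → side q ≡ right → ⊥
    mono (p≢u , _ , refl , up) (q≢u , _ , refl , uq) l r
      with pairwise edge-sym ((ab ∷ ac ∷ []) ∷ (bc ∷ []) ∷ [] ∷ [])
                    (Enumeration.complete nbrs up) (Enumeration.complete nbrs uq)
    ... | inj₁ refl = case trans (sym l) r of λ ()
    ... | inj₂ pq   = separated (pq , p≢u , q≢u) l r

  -- Among the neighbours of `u` only the disjoint pairs `ab` and `cd` can be nonadjacent. `G′`
  -- deletes `u` and adds `ab`, so a cut of `G′` can split the neighbourhood only between `c` and
  -- `d`.
  module Opposite {u a b c d} (vu : Vertex u) (deg≡4 : deg u ≡ 4) (nbrs : Neighbours u (a ∷ b ∷ c ∷ d ∷ []))
    (ac : Edge a c) (ad : Edge a d) (bc : Edge b c) (bd : Edge b d) where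

    ua : Edge u a
    ua = All.lookup (Enumeration.sound nbrs) (here refl)
    ub : Edge u b
    ub = All.lookup (Enumeration.sound nbrs) (there (here refl))
    uc : Edge u c
    uc = All.lookup (Enumeration.sound nbrs) (there (there (here refl)))
    ud : Edge u d
    ud = All.lookup (Enumeration.sound nbrs) (there (there (there (here refl))))

    off-u : ∀ {x} → Edge u x → x ≢ u
    off-u e = edge⇒≢ (edge-sym e)

    a≢b : a ≢ b
    a≢b with Enumeration.unique nbrs
    ... | (a≢b ∷ _) ∷ _ = a≢b

    va′ : PartialGraph.Vertex (delete G u) a
    va′ = edge-vertex ac , off-u ua
    vb′ : PartialGraph.Vertex (delete G u) b
    vb′ = edge-vertex bc , off-u ub

    G′ : PartialGraph N
    G′ = join (delete G u) a b va′ vb′ a≢b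

    abstract
      C : Cut G′
      C = smaller G′ (size-delete<size G u vu)
            -- Deleting `u` lowers the degree sum by at least `8` and the edge `ab` returns at most
            -- `2`; again `22 ≤ 5 * 6`.
            (sparse-descend G G′ {6} {1} edges (size≤size-delete+1 G u) (m≤m+n 22 8) sparse)
        where
        open ≤-Reasoning
        edges : PartialGraph.degreeSum G′ + 6 ≤ degreeSum
        edges = begin
          PartialGraph.degreeSum G′ + 6                     ≤⟨ +-monoˡ-≤ 6 (degreeSum-join (delete G u) va′ vb′ a≢b) ⟩
          PartialGraph.degreeSum (delete G u) + 2 + 6       ≡⟨ +-assoc _ 2 6 ⟩
          PartialGraph.degreeSum (delete G u) + 8           ≡⟨ cong (λ k → PartialGraph.degreeSum (delete G u) + 2 * k) deg≡4 ⟨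
          PartialGraph.degreeSum (delete G u) + 2 * deg u   ≤⟨ degreeSum-delete G u ⟩
          degreeSum                                         ∎

    open Cut C
    private module G′ = PartialGraph G′

    keep : ∀ {x y} → x ≢ u → y ≢ u → Edge x y → G′.Edge x y
    keep x≢u y≢u e = inj₁ (e , x≢u , y≢u)

    -- Putting u into the cut subdivides the edge ab added in G′.
    subdivide : ¬ Edge a b → (∀ {y} → Edge u y → side y ≡ cut → y ≡ a ⊎ y ≡ b) → Cut G
    subdivide ¬ab only = record
      { side      = λ x → side′ x (x ≟ u)
      ; separated = λ {x} {y} → separated′ (x ≟ u) (y ≟ u)
      ; on-left   = let x , (v , x≢u) , s = on-left in x , v , trans (off (x ≟ u) x≢u) s
      ; on-right  = let x , (v , x≢u) , s = on-right in x , v , trans (off (x ≟ u) x≢u) s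
      ; forest    = no-core
      }
      where
      side′ : ∀ x → Dec (x ≡ u) → Side
      side′ x (yes _) = cut
      side′ x (no _)  = side x
      off : ∀ {x} (e : Dec (x ≡ u)) → x ≢ u → side′ x e ≡ side x
      off (yes p) ¬p = contradiction p ¬p
      off (no _)  _  = refl
      separated′ : ∀ {x y} (e : Dec (x ≡ u)) (f : Dec (y ≡ u)) → Edge x y →
                   side′ x e ≡ left → side′ y f ≡ right → ⊥
      separated′ (no x≢u) (no y≢u) xy l r = separated (keep x≢u y≢u xy) l r

      module _ {T} (core : Core G T) (T⊆ : ∀ {x} → T x → side′ x (x ≟ u) ≡ cut) where
        T′ : Fin N → Set
        T′ x = T x × x ≢ u

        in-cut : ∀ {x} → T′ x → side x ≡ cut
        in-cut {x} (tx , x≢u) = trans (sym (off (x ≟ u) x≢u)) (T⊆ tx)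

        ends : T u → T′ a × T′ b
        ends tu with Core.branching core tu
        ... | y , z , y≢z , (ty , uy) , (tz , uz)
          with only uy (in-cut (ty , off-u uy)) | only uz (in-cut (tz , off-u uz))
        ... | inj₁ refl | inj₁ refl = contradiction refl y≢z
        ... | inj₁ refl | inj₂ refl = (ty , off-u uy) , (tz , off-u uz)
        ... | inj₂ refl | inj₁ refl = (tz , off-u uz) , (ty , off-u uy)
        ... | inj₂ refl | inj₂ refl = contradiction refl y≢z

        Branches : Fin N → Set
        Branches x = ∃[ y ] ∃[ z ] (y ≢ z × (T′ y × G′.Edge x y) × (T′ z × G′.Edge x z))

        -- A core vertex adjacent to `u` is `a` or `b`. Its neighbour `u` is replaced by the other
        -- end of the new edge, which differs from `z` because `ab` is not an edge of `G`.
        reroute : ∀ {x z} → T′ x → Edge x u → T u → T′ z → Edge x z → Branches x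
        reroute {x} {z} tx xu tu tz xz with only (edge-sym xu) (in-cut tx)
        ... | inj₁ refl = b , z , (λ { refl → ¬ab xz }) ,
                          (proj₂ (ends tu) , inj₂ (inj₁ (refl , refl))) , (tz , keep (proj₂ tx) (proj₂ tz) xz)
        ... | inj₂ refl = a , z , (λ { refl → ¬ab (edge-sym xz) }) ,
                          (proj₁ (ends tu) , inj₂ (inj₂ (refl , refl))) , (tz , keep (proj₂ tx) (proj₂ tz) xz)

        branches : ∀ {x} → T′ x → Branches x
        branches {x} (tx , x≢u) with Core.branching core tx
        ... | y , z , y≢z , (ty , xy) , (tz , xz) with y ≟ u | z ≟ u
        ... | yes refl | yes refl = contradiction refl y≢z
        ... | yes refl | no z≢u   = reroute (tx , x≢u) xy ty (tz , z≢u) xz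
        ... | no y≢u   | yes refl = reroute (tx , x≢u) xz tz (ty , y≢u) xy
        ... | no y≢u   | no z≢u   =
          y , z , y≢z , ((ty , y≢u) , keep x≢u y≢u xy) , ((tz , z≢u) , keep x≢u z≢u xz)

        inhabited : ∃ T′
        inhabited with Core.inhabited core
        ... | x , tx with x ≟ u
        ... | no x≢u   = x , tx , x≢u
        ... | yes refl = a , proj₁ (ends tx)

        no-core : ⊥
        no-core = forest (record { inhabited = inhabited ; branching = branches }) in-cut

    AdjacentOrOpposite : Fin N → Fin N → Set
    AdjacentOrOpposite p q = G′.Edge p q ⊎ ((p ≡ c × q ≡ d) ⊎ (p ≡ d × q ≡ c))

    pairs : ∀ {p q} → p ∈ a ∷ b ∷ c ∷ d ∷ [] → q ∈ a ∷ b ∷ c ∷ d ∷ [] → p ≡ q ⊎ AdjacentOrOpposite p q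
    pairs = pairwise {R = AdjacentOrOpposite}
      (λ { (inj₁ e) → inj₁ (G′.edge-sym e)
         ; (inj₂ (inj₁ (s , t))) → inj₂ (inj₂ (t , s))
         ; (inj₂ (inj₂ (s , t))) → inj₂ (inj₁ (t , s)) })
      ((inj₁ (inj₂ (inj₁ (refl , refl))) ∷ inj₁ (keep (off-u ua) (off-u uc) ac) ∷ inj₁ (keep (off-u ua) (off-u ud) ad) ∷ []) ∷
       (inj₁ (keep (off-u ub) (off-u uc) bc) ∷ inj₁ (keep (off-u ub) (off-u ud) bd) ∷ []) ∷
       (inj₂ (inj₁ (refl , refl)) ∷ []) ∷ [] ∷ [])

    -- Here `l` and `r` are `c` and `d` in either order. Both are off the cut, so the neighbours of
    -- `u` in the cut are among `a` and `b`, as `subdivide` requires.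
    bichromatic : ∀ {l r} → (∀ {y} → y ∈ a ∷ b ∷ c ∷ d ∷ [] → y ≡ a ⊎ y ≡ b ⊎ y ≡ l ⊎ y ≡ r) →
                  side l ≡ left → side r ≡ right → ¬ Edge a b → Cut G
    bichromatic split l r ¬ab = subdivide ¬ab λ uy s → case split (Enumeration.complete nbrs uy) of λ where
      (inj₁ y≡a) → inj₁ y≡a
      (inj₂ (inj₁ y≡b)) → inj₂ y≡b
      (inj₂ (inj₂ (inj₁ refl))) → case trans (sym s) l of λ ()
      (inj₂ (inj₂ (inj₂ refl))) → case trans (sym s) r of λ ()

    -- If the cut of `G′` puts `c` and `d` on different sides, then `cd` is not an edge, hence `ab`
    -- is not one either and `u` may enter the cut. Otherwise the neighbourhood is not split and `u`
    -- joins a side.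
    reduce : Edge c d ⊎ ¬ Edge a b → Cut G
    reduce h with side c ≟ˢ left ×-dec side d ≟ˢ right | side c ≟ˢ right ×-dec side d ≟ˢ left
    ... | yes (l , r) | _ with h
    ...   | inj₁ cd  = ⊥-elim (separated (keep (off-u uc) (off-u ud) cd) l r)
    ...   | inj₂ ¬ab = bichromatic (λ { (here p) → inj₁ p ; (there (here p)) → inj₂ (inj₁ p)
            ; (there (there (here p))) → inj₂ (inj₂ (inj₁ p))
            ; (there (there (there (here p)))) → inj₂ (inj₂ (inj₂ p)) }) l r ¬ab
    reduce h | no _ | yes (r , l) with h
    ...   | inj₁ cd  = ⊥-elim (separated (keep (off-u ud) (off-u uc) (edge-sym cd)) l r)
    ...   | inj₂ ¬ab = bichromatic (λ { (here p) → inj₁ p ; (there (here p)) → inj₂ (inj₁ p)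
            ; (there (there (here p))) → inj₂ (inj₂ (inj₂ p))
            ; (there (there (there (here p)))) → inj₂ (inj₂ (inj₁ p)) }) l r ¬ab
    reduce h | no ¬lr | no ¬rl = extend G G′ (_≟ u) id keep C mono
      where
      mono : ∀ {p q} → Boundary G G′ (_≟ u) p → Boundary G G′ (_≟ u) q →
             side p ≡ left → side q ≡ right → ⊥
      mono (_ , _ , refl , up) (_ , _ , refl , uq) l r
        with pairs (Enumeration.complete nbrs up) (Enumeration.complete nbrs uq)
      ... | inj₁ refl = case trans (sym l) r of λ ()
      ... | inj₂ (inj₁ pq) = separated pq l r
      ... | inj₂ (inj₂ (inj₁ (refl , refl))) = ¬lr (l , r)
      ... | inj₂ (inj₂ (inj₂ (refl , refl))) = ¬rl (r , l)

  -- Neighbourhoods of vertices of degree three and four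

  leaf-↭ : ∀ {x xs ys} → xs ↭ ys → Leaf G x ys → Leaf G x xs
  leaf-↭ p l i j = l (∈-resp-↭ p i) (∈-resp-↭ p j)

  -- A vertex that is no leaf has two neighbours among the three, and `y` is not one of them.
  nonleaf : ∀ {x y z w xs} → xs ↭ y ∷ z ∷ w ∷ [] → ¬ Leaf G x xs → ¬ Edge x y → Edge x z × Edge x w
  nonleaf {x} {y} {z} {w} p ¬leaf ¬xy with edge? x z | edge? x w
  ... | yes xz | yes xw = xz , xw
  ... | no ¬xz | _      = ⊥-elim
        (¬leaf (leaf-↭ p (leaf-skip G ¬xy (leaf-pair G (λ (e , _) → ¬xz e)))))
  ... | yes _  | no ¬xw = ⊥-elim
        (¬leaf (leaf-↭ p (leaf-skip G ¬xy (leaf-pair G (λ (_ , e) → ¬xw e)))))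

  record K₄WithLeaf (u : Fin N) : Set where
    field
      {a b c d}  : Fin N
      neighbours : Neighbours u (a ∷ b ∷ c ∷ d ∷ [])
      ab         : Edge a b
      ac         : Edge a c
      bc         : Edge b c
      leaf       : Leaf G d (a ∷ b ∷ c ∷ [])

    open Enumeration neighbours public

    ua : Edge u a
    ua = All.lookup sound (here refl)
    ub : Edge u b
    ub = All.lookup sound (there (here refl))
    uc : Edge u c
    uc = All.lookup sound (there (there (here refl)))
    ud : Edge u d
    ud = All.lookup sound (there (there (there (here refl))))

    near : ∀ {x} → Edge u x → x ≢ d → x ∈ a ∷ b ∷ c ∷ []
    near ux x≢d with complete ux
    ... | here p                         = here p
    ... | there (here p)                 = there (here p)
    ... | there (there (here p))         = there (there (here p))
    ... | there (there (there (here p))) = contradiction p x≢d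

    clique : ∀ {x y} → Edge u x → Edge u y → x ≢ d → y ≢ d → x ≢ y → Edge x y
    clique ux uy x≢d y≢d x≢y
      with pairwise edge-sym ((ab ∷ ac ∷ []) ∷ (bc ∷ []) ∷ [] ∷ []) (near ux x≢d) (near uy y≢d)
    ... | inj₁ x≡y = contradiction x≡y x≢y
    ... | inj₂ xy  = xy

    leaf-unique : ∀ {x y} → Edge u x → Edge u y → Edge d x → Edge d y → x ≡ y
    leaf-unique ux uy dx dy =
      leaf (near ux (edge⇒≢ (edge-sym dx))) (near uy (edge⇒≢ (edge-sym dy))) dx dy

  -- A missing edge at `a` allows `a` to be removed first; if only `bc` is missing, `b` is removed
  -- first.
  triangle-or-eliminable : ∀ a b c → (Edge a b × Edge a c × Edge b c) ⊎
    Eliminable G (a ∷ b ∷ c ∷ []) ⊎ Eliminable G (b ∷ a ∷ c ∷ [])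
  triangle-or-eliminable a b c with edge? a b | edge? a c | edge? b c
  ... | yes ab | yes ac | yes bc = inj₁ (ab , ac , bc)
  ... | no ¬ab | _      | _      = inj₂ (inj₁ (leaf-pair G (λ (e , _) → ¬ab e) ∷ leaf-[-] G ∷ leaf-[] G ∷ []))
  ... | yes _  | no ¬ac | _      = inj₂ (inj₁ (leaf-pair G (λ (_ , e) → ¬ac e) ∷ leaf-[-] G ∷ leaf-[] G ∷ []))
  ... | yes _  | yes _  | no ¬bc = inj₂ (inj₂ (leaf-pair G (λ (_ , e) → ¬bc e) ∷ leaf-[-] G ∷ leaf-[] G ∷ []))

  degree-three : ∀ {u} → Vertex u → deg u ≡ 3 → 4 < size → Cut G
  degree-three {u} vu deg≡3 big with enumerate (edge? u)
  ... | xs , nbrs , len with three xs (trans len deg≡3)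
  ... | a , b , c , refl with triangle-or-eliminable a b c
  ... | inj₁ (ab , ac , bc) = reduce-triangle vu deg≡3 nbrs ab ac bc
  ... | inj₂ (inj₁ elim)    = cut-at vu (Enumeration.complete nbrs) elim big
  ... | inj₂ (inj₂ elim)    =
    cut-at vu (λ e → ∈-resp-↭ (↭-swap a b ↭-refl) (Enumeration.complete nbrs e)) elim big

  module DegreeFour {u} (vu : Vertex u) (deg≡4 : deg u ≡ 4) (big : 5 < size) where

    -- Unless `a`, `b`, `c` form a triangle, removing the leaf `d` first shows that the
    -- neighbourhood of `u` is a forest, and it cuts off `u`.
    leaf-case : ∀ {a b c d} → Neighbours u (a ∷ b ∷ c ∷ d ∷ []) → Leaf G d (a ∷ b ∷ c ∷ []) →
                Cut G ⊎ K₄WithLeaf u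
    leaf-case {a} {b} {c} {d} nbrs leaf with triangle-or-eliminable a b c
    ... | inj₁ (ab , ac , bc) =
      inj₂ (record { neighbours = nbrs ; ab = ab ; ac = ac ; bc = bc ; leaf = leaf })
    ... | inj₂ (inj₁ elim) =
      inj₁ (cut-at vu (λ e → ∈-resp-↭ last-first (Enumeration.complete nbrs e)) (leaf ∷ elim) big)
      where
      last-first : a ∷ b ∷ c ∷ d ∷ [] ↭ d ∷ a ∷ b ∷ c ∷ []
      last-first = ↭-sym (∷↭∷ʳ d (a ∷ b ∷ c ∷ []))
    ... | inj₂ (inj₂ elim) =
      inj₁ (cut-at vu (λ e → ∈-resp-↭ last-first (Enumeration.complete nbrs e))
                      (leaf-↭ (↭-swap b a ↭-refl) leaf ∷ elim) big)
      where
      last-first : a ∷ b ∷ c ∷ d ∷ [] ↭ d ∷ b ∷ a ∷ c ∷ []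
      last-first = ↭-trans (↭-sym (∷↭∷ʳ d (a ∷ b ∷ c ∷ []))) (↭-prep d (↭-swap a b ↭-refl))

    -- The lists run cyclically, so that `rotate` is a symmetry and the six pairs reduce to one side
    -- `ab` and one diagonal `ac`.
    record NoLeaf (a b c d : Fin N) : Set where
      constructor noLeaf
      field
        neighbours : Neighbours u (a ∷ b ∷ c ∷ d ∷ [])
        ¬leaf-a    : ¬ Leaf G a (b ∷ c ∷ d ∷ [])
        ¬leaf-b    : ¬ Leaf G b (c ∷ d ∷ a ∷ [])
        ¬leaf-c    : ¬ Leaf G c (d ∷ a ∷ b ∷ [])
        ¬leaf-d    : ¬ Leaf G d (a ∷ b ∷ c ∷ [])

    rotate : ∀ {a b c d} → NoLeaf a b c d → NoLeaf b c d a
    rotate {a} {b} {c} {d} (noLeaf nbrs la lb lc ld) = noLeaf (permute (∷↭∷ʳ a (b ∷ c ∷ d ∷ [])) nbrs) lb lc ld la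

    nonadjacent-sides : ∀ {a b c d} → NoLeaf a b c d → ¬ Edge a b → Cut G
    nonadjacent-sides {a} {b} {c} {d} (noLeaf nbrs la lb _ _) ¬ab =
      let ac , ad = nonleaf ↭-refl la ¬ab
          bc , bd = nonleaf (↭-sym (∷↭∷ʳ a (c ∷ d ∷ []))) lb (¬ab ∘ edge-sym)
      in Opposite.reduce vu deg≡4 nbrs ac ad bc bd (inj₂ ¬ab)

    nonadjacent-diagonal : ∀ {a b c d} → NoLeaf a b c d → ¬ Edge a c → Cut G
    nonadjacent-diagonal {a} {b} {c} {d} (noLeaf nbrs la _ lc _) ¬ac =
      let ab , ad = nonleaf (↭-swap b c ↭-refl) la ¬ac
          cd , cb = nonleaf (↭-swap d a ↭-refl) lc (¬ac ∘ edge-sym)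
      in Opposite.reduce vu deg≡4 (permute (↭-prep a (↭-swap b c ↭-refl)) nbrs) ab ad cb cd (inj₂ ¬ac)

    -- By `nonleaf` both ends of a missing pair are adjacent to the other two neighbours, which is
    -- the situation of `Opposite`. If no pair is missing, the edge `cd` is what rules out a split
    -- there.
    no-leaf : ∀ {a b c d} → NoLeaf a b c d → Cut G
    no-leaf {a} {b} {c} {d} h
      with edge? a b | edge? b c | edge? c d | edge? d a | edge? a c | edge? b d
    ... | no ¬ab | _ | _ | _ | _ | _ = nonadjacent-sides h ¬ab
    ... | yes _ | no ¬bc | _ | _ | _ | _ = nonadjacent-sides (rotate h) ¬bc
    ... | yes _ | yes _ | no ¬cd | _ | _ | _ = nonadjacent-sides (rotate (rotate h)) ¬cd
    ... | yes _ | yes _ | yes _ | no ¬da | _ | _ = nonadjacent-sides (rotate (rotate (rotate h))) ¬da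
    ... | yes _ | yes _ | yes _ | yes _ | no ¬ac | _ = nonadjacent-diagonal h ¬ac
    ... | yes _ | yes _ | yes _ | yes _ | yes _ | no ¬bd = nonadjacent-diagonal (rotate h) ¬bd
    ... | yes ab | yes bc | yes cd | yes da | yes ac | yes bd =
      Opposite.reduce vu deg≡4 (NoLeaf.neighbours h) ac (edge-sym da) bc bd (inj₁ cd)

    classify : Cut G ⊎ K₄WithLeaf u
    classify with enumerate (edge? u)
    ... | xs , nbrs , len with four xs (trans len deg≡4)
    ... | a , b , c , d , refl
      with leaf? G a (b ∷ c ∷ d ∷ []) | leaf? G b (c ∷ d ∷ a ∷ [])
         | leaf? G c (d ∷ a ∷ b ∷ []) | leaf? G d (a ∷ b ∷ c ∷ [])
    ... | no la | no lb | no lc | no ld = inj₁ (no-leaf (noLeaf nbrs la lb lc ld))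
    ... | _ | _ | _ | yes ld = leaf-case nbrs ld
    ... | yes la | _ | _ | no _ = leaf-case (permute (∷↭∷ʳ a (b ∷ c ∷ d ∷ [])) nbrs) la
    ... | no _ | yes lb | _ | no _ =
      leaf-case (permute (↭-trans (∷↭∷ʳ a (b ∷ c ∷ d ∷ [])) (∷↭∷ʳ b (c ∷ d ∷ a ∷ []))) nbrs) lb
    ... | no _ | no _ | yes lc | no _ =
      leaf-case (permute (↭-sym (∷↭∷ʳ d (a ∷ b ∷ c ∷ []))) nbrs) lc

  -- Two adjacent vertices of degree four

  module AdjacentPair {u} (vu : Vertex u) (deg-u≡4 : deg u ≡ 4) (Ku : K₄WithLeaf u)
    (deg-a≡4 : deg (K₄WithLeaf.a Ku) ≡ 4) (Ka : K₄WithLeaf (K₄WithLeaf.a Ku)) where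
    open K₄WithLeaf Ku
    private module Ka = K₄WithLeaf Ka

    -- The neighbour of `a` outside its K₄. The lemmas below place all outer neighbours of `u` and
    -- `a` among `d`, `s`, `b`, `c`, where `d` and `s` may coincide.
    s : Fin N
    s = Ka.d

    au : Edge a u
    au = edge-sym ua

    as : Edge a s
    as = Ka.ud

    distinct : (a ≢ b × a ≢ c × a ≢ d) × (b ≢ c × b ≢ d) × c ≢ d
    distinct with unique
    ... | (p ∷ q ∷ r ∷ []) ∷ (p′ ∷ q′ ∷ []) ∷ (p″ ∷ []) ∷ _ = (p , q , r) , (p′ , q′) , p″

    a≢b : a ≢ b
    a≢b = proj₁ (proj₁ distinct)
    a≢d : a ≢ d
    a≢d = proj₂ (proj₂ (proj₁ distinct))
    b≢c : b ≢ c
    b≢c = proj₁ (proj₁ (proj₂ distinct))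
    b≢d : b ≢ d
    b≢d = proj₂ (proj₁ (proj₂ distinct))
    c≢d : c ≢ d
    c≢d = proj₂ (proj₂ distinct)

    -- Each of `u`, `b`, `c` is adjacent to the other two, whereas `s` has at most one neighbour
    -- among the other neighbours of `a`. The same reason separates `b` and `c` from `s`.
    u≢s : u ≢ s
    u≢s u≡s = b≢c (Ka.leaf-unique ab ac (subst (λ v → Edge v b) u≡s ub) (subst (λ v → Edge v c) u≡s uc))

    b≢s : b ≢ s
    b≢s b≡s = edge⇒≢ uc
      (Ka.leaf-unique au ac (subst (λ v → Edge v u) b≡s (edge-sym ub)) (subst (λ v → Edge v c) b≡s bc))

    c≢s : c ≢ s
    c≢s c≡s = edge⇒≢ ub
      (Ka.leaf-unique au ab (subst (λ v → Edge v u) c≡s (edge-sym uc)) (subst (λ v → Edge v b) c≡s (edge-sym bc)))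

    -- Apart from `s` the neighbours of `a` form a clique containing `u`, so `x` is also a neighbour
    -- of `u`. It cannot be `d`, which would then be adjacent to both `a` and `b`.
    neighbour-of-a : ∀ {x} → Edge a x → x ≡ u ⊎ x ∈ d ∷ s ∷ b ∷ c ∷ []
    neighbour-of-a {x} ax with x ≟ s | x ≟ u
    ... | yes x≡s | _       = inj₂ (there (here x≡s))
    ... | no _    | yes x≡u = inj₁ x≡u
    ... | no x≢s  | no x≢u with complete (Ka.clique au ax u≢s x≢s (≢-sym x≢u))
    ... | here refl                         = contradiction ax edge-irrefl
    ... | there (here p)                    = inj₂ (there (there (here p)))
    ... | there (there (here p))            = inj₂ (there (there (there (here p))))
    ... | there (there (there (here refl))) = contradiction
          (leaf-unique ua ub (edge-sym ax) (Ka.clique ax ab x≢s b≢s (≢-sym b≢d))) a≢b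

    neighbour-of-u : ∀ {x} → Edge u x → x ≡ a ⊎ x ∈ d ∷ s ∷ b ∷ c ∷ []
    neighbour-of-u ux with complete ux
    ... | here p                         = inj₁ p
    ... | there (here p)                 = inj₂ (there (there (here p)))
    ... | there (there (here p))         = inj₂ (there (there (there (here p))))
    ... | there (there (there (here p))) = inj₂ (here p)

    closed : ∀ {x y} → x ∈ u ∷ a ∷ [] → Edge x y → y ∈ u ∷ a ∷ [] ⊎ y ∈ d ∷ s ∷ b ∷ c ∷ []
    closed (here refl) e with neighbour-of-u e
    ... | inj₁ p = inj₁ (there (here p))
    ... | inj₂ p = inj₂ p
    closed (there (here refl)) e with neighbour-of-a e
    ... | inj₁ p = inj₁ (here p)
    ... | inj₂ p = inj₂ p

    ¬db×dc : ¬ (Edge d b × Edge d c)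
    ¬db×dc (db , dc) = b≢c (leaf-unique ub uc db dc)

    ¬sb×sc : ¬ (Edge s b × Edge s c)
    ¬sb×sc (sb , sc) = b≢c (Ka.leaf-unique ab ac sb sc)

    Deleted : Fin N → Set
    Deleted x = x ≡ u ⊎ x ≡ a

    deleted? : Decidable Deleted
    deleted? x = x ≟ u ⊎-dec x ≟ a

    -- With d adjacent to s, adding the edges d-x and s-y completes the outer boundary of {u, a}
    -- to a clique, so no cut of the smaller graph can split it.
    module Completion {x y} (ds : Edge d s) (ux : Edge u x) (ax : Edge a x) (uy : Edge u y) (ay : Edge a y)
      (d≢x : d ≢ x) (s≢y : s ≢ y)
      (db : b ≡ x ⊎ Edge d b) (dc : c ≡ x ⊎ Edge d c) (sb : b ≡ y ⊎ Edge s b) (sc : c ≡ y ⊎ Edge s c) where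

      G₁ G₂ : PartialGraph N
      G₁ = delete G u
      G₂ = delete G₁ a

      vertex₂ : ∀ {v} → Vertex v → v ≢ u → v ≢ a → PartialGraph.Vertex G₂ v
      vertex₂ v v≢u v≢a = (v , v≢u) , v≢a

      vd = vertex₂ (edge-vertex ds) (edge⇒≢ (edge-sym ud)) (≢-sym a≢d)
      vx = vertex₂ (edge-vertex (edge-sym ux)) (edge⇒≢ (edge-sym ux)) (edge⇒≢ (edge-sym ax))
      vs = vertex₂ (edge-vertex (edge-sym ds)) (≢-sym u≢s) (edge⇒≢ (edge-sym as))
      vy = vertex₂ (edge-vertex (edge-sym uy)) (edge⇒≢ (edge-sym uy)) (edge⇒≢ (edge-sym ay))

      G₃ G₄ : PartialGraph N
      G₃ = join G₂ d x vd vx d≢x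
      G₄ = join G₃ s y vs vy s≢y

      private
        module G₁ = PartialGraph G₁
        module G₂ = PartialGraph G₂
        module G₃ = PartialGraph G₃
        module G₄ = PartialGraph G₄

      abstract
        C : Cut G₄
        C = smaller G₄
          (<-trans (size-delete<size G₁ a (edge-vertex au , edge⇒≢ au)) (size-delete<size G u vu))
          -- Deleting `u` lowers the degree sum by at least `8`, then deleting `a`, still of degree
          -- at least three, by at least `6`; the two joins return at most `4`. This leaves `10`,
          -- and `22 * 2 ≤ 5 * 10`.
          (sparse-descend G G₄ {10} {2} edges vertices (m≤m+n 44 6) sparse)
          where
          open ≤-Reasoning
          vertices : size ≤ G₄.size + 2
          vertices = begin
            size                ≤⟨ size≤size-delete+1 G u ⟩
            G₁.size + 1         ≤⟨ +-monoˡ-≤ 1 (size≤size-delete+1 G₁ a) ⟩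
            G₂.size + 1 + 1     ≡⟨ +-assoc G₂.size 1 1 ⟩
            G₂.size + 2         ∎
          3≤deg₁ : 3 ≤ G₁.deg a
          3≤deg₁ = +-cancelʳ-≤ 1 3 (G₁.deg a)
            (≤-trans (≤-reflexive (sym deg-a≡4)) (deg≤deg-delete+1 G u (edge⇒≢ au)))
          edges : G₄.degreeSum + 10 ≤ degreeSum
          edges = begin
            G₄.degreeSum + 10                ≤⟨ +-monoˡ-≤ 10 (degreeSum-join G₃ vs vy s≢y) ⟩
            G₃.degreeSum + 2 + 10            ≤⟨ +-monoˡ-≤ 10 (+-monoˡ-≤ 2 (degreeSum-join G₂ vd vx d≢x)) ⟩
            G₂.degreeSum + 2 + 2 + 10        ≡⟨ regroup G₂.degreeSum ⟩
            G₂.degreeSum + 2 * 3 + 2 * 4     ≤⟨ +-monoˡ-≤ 8 (+-monoʳ-≤ G₂.degreeSum (*-monoʳ-≤ 2 3≤deg₁)) ⟩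
            G₂.degreeSum + 2 * G₁.deg a + 8  ≤⟨ +-monoˡ-≤ 8 (degreeSum-delete G₁ a) ⟩
            G₁.degreeSum + 8                 ≡⟨ cong (λ k → G₁.degreeSum + 2 * k) deg-u≡4 ⟨
            G₁.degreeSum + 2 * deg u         ≤⟨ degreeSum-delete G u ⟩
            degreeSum                        ∎
            where
            open +-*-Solver
            regroup : ∀ m → m + 2 + 2 + 10 ≡ m + 2 * 3 + 2 * 4
            regroup = solve 1 (λ m → m :+ con 2 :+ con 2 :+ con 10 := m :+ con 6 :+ con 8) refl

      open Cut C

      keep : ∀ {p q} → ¬ Deleted p → ¬ Deleted q → Edge p q → G₄.Edge p q
      keep ¬p ¬q e = inj₁ (inj₁ ((e , ¬p ∘ inj₁ , ¬q ∘ inj₁) , ¬p ∘ inj₂ , ¬q ∘ inj₂))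

      kept : ∀ {v} → v ≢ u → v ≢ a → ¬ Deleted v
      kept v≢u v≢a = [ v≢u , v≢a ]

      ¬b : ¬ Deleted b
      ¬b = kept (edge⇒≢ (edge-sym ub)) (edge⇒≢ (edge-sym ab))
      ¬c : ¬ Deleted c
      ¬c = kept (edge⇒≢ (edge-sym uc)) (edge⇒≢ (edge-sym ac))
      ¬d : ¬ Deleted d
      ¬d = kept (edge⇒≢ (edge-sym ud)) (≢-sym a≢d)
      ¬s : ¬ Deleted s
      ¬s = kept (≢-sym u≢s) (edge⇒≢ (edge-sym as))

      from-d : ∀ {v} → ¬ Deleted v → v ≡ x ⊎ Edge d v → G₄.Edge d v
      from-d ¬v (inj₁ refl) = inj₁ (inj₂ (inj₁ (refl , refl)))
      from-d ¬v (inj₂ e)    = keep ¬d ¬v e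

      from-s : ∀ {v} → ¬ Deleted v → v ≡ y ⊎ Edge s v → G₄.Edge s v
      from-s ¬v (inj₁ refl) = inj₂ (inj₁ (refl , refl))
      from-s ¬v (inj₂ e)    = keep ¬s ¬v e

      boundary : ∀ {p} → Boundary G G₄ deleted? p → p ∈ d ∷ s ∷ b ∷ c ∷ []
      boundary (¬p , _ , inj₁ refl , e) with neighbour-of-u e
      ... | inj₁ refl = contradiction (inj₂ refl) ¬p
      ... | inj₂ p    = p
      boundary (¬p , _ , inj₂ refl , e) with neighbour-of-a e
      ... | inj₁ refl = contradiction (inj₁ refl) ¬p
      ... | inj₂ p    = p

      mono : ∀ {p q} → Boundary G G₄ deleted? p → Boundary G G₄ deleted? q →
             side p ≡ left → side q ≡ right → ⊥
      mono p q l r with pairwise {R = G₄.Edge} G₄.edge-sym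
          ((keep ¬d ¬s ds ∷ from-d ¬b db ∷ from-d ¬c dc ∷ []) ∷
           (from-s ¬b sb ∷ from-s ¬c sc ∷ []) ∷ (keep ¬b ¬c bc ∷ []) ∷ [] ∷ [])
          (boundary p) (boundary q)
      ... | inj₁ refl = case trans (sym l) r of λ ()
      ... | inj₂ pq   = separated pq l r

      reduce : Cut G
      reduce = extend G G₄ deleted? (λ ((v , v≢u) , v≢a) → v , kept v≢u v≢a) keep C mono

    -- Each of `d` and `s` has at most one neighbour in `b`, `c`. If `ds` is missing, or one of `d`,
    -- `s` has no such neighbour, then `d`, `s`, `b`, `c` induce a forest. Otherwise each has
    -- exactly one, and the two missing edges are added by `Completion`.
    cut-pair : 6 < size → Cut G
    cut-pair big with edge? d s
    -- This includes `d ≡ s`: the list then repeats an entry, which is not adjacent to itself.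
    ... | no ¬ds = cut-around G (u ∷ a ∷ []) (d ∷ s ∷ b ∷ c ∷ []) (here refl) vu closed
            (leaf-skip G ¬ds (leaf-pair G ¬db×dc) ∷ leaf-pair G ¬sb×sc ∷ leaf-[-] G ∷ leaf-[] G ∷ []) big
    ... | yes ds with edge? d b | edge? d c | edge? s b | edge? s c
    ...   | no ¬db | no ¬dc | _ | _ = cut-around G (u ∷ a ∷ []) (d ∷ s ∷ b ∷ c ∷ []) (here refl) vu closed
            (leaf-↭ (∷↭∷ʳ s (b ∷ c ∷ [])) (leaf-skip G ¬db (leaf-skip G ¬dc (leaf-[-] G)))
              ∷ leaf-pair G ¬sb×sc ∷ leaf-[-] G ∷ leaf-[] G ∷ []) big
    ...   | _ | _ | no ¬sb | no ¬sc = cut-around G (u ∷ a ∷ []) (s ∷ d ∷ b ∷ c ∷ []) (here refl) vu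
            (λ p e → map₂ (∈-resp-↭ (↭-swap d s ↭-refl)) (closed p e))
            (leaf-↭ (∷↭∷ʳ d (b ∷ c ∷ [])) (leaf-skip G ¬sb (leaf-skip G ¬sc (leaf-[-] G)))
              ∷ leaf-pair G ¬db×dc ∷ leaf-[-] G ∷ leaf-[] G ∷ []) big
    ...   | yes db | yes dc | _ | _ = contradiction (db , dc) ¬db×dc
    ...   | _ | _ | yes sb | yes sc = contradiction (sb , sc) ¬sb×sc
    ...   | yes db | no _ | yes sb | no _ =
            Completion.reduce ds uc ac uc ac (≢-sym c≢d) (≢-sym c≢s) (inj₂ db) (inj₁ refl) (inj₂ sb) (inj₁ refl)
    ...   | yes db | no _ | no _ | yes sc =
            Completion.reduce ds uc ac ub ab (≢-sym c≢d) (≢-sym b≢s) (inj₂ db) (inj₁ refl) (inj₁ refl) (inj₂ sc)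
    ...   | no _ | yes dc | yes sb | no _ =
            Completion.reduce ds ub ab uc ac (≢-sym b≢d) (≢-sym c≢s) (inj₁ refl) (inj₂ dc) (inj₂ sb) (inj₁ refl)
    ...   | no _ | yes dc | no _ | yes sc =
            Completion.reduce ds ub ab ub ab (≢-sym b≢d) (≢-sym b≢s) (inj₁ refl) (inj₂ dc) (inj₁ refl) (inj₂ sc)

  -- Heavy triangles and discharging

  swap-ab : ∀ {u} → K₄WithLeaf u → K₄WithLeaf u
  swap-ab K = record
    { neighbours = permute (↭-swap a b ↭-refl) neighbours
    ; ab = edge-sym ab ; ac = bc ; bc = ac
    ; leaf = leaf-↭ (↭-swap b a ↭-refl) leaf
    } where open K₄WithLeaf K

  swap-ac : ∀ {u} → K₄WithLeaf u → K₄WithLeaf u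
  swap-ac K = record
    { neighbours = permute (reverse (d ∷ [])) neighbours
    ; ab = edge-sym bc ; ac = edge-sym ac ; bc = edge-sym ab
    ; leaf = leaf-↭ (↭-sym (reverse [])) leaf
    }
    where
    open K₄WithLeaf K
    reverse : ∀ xs → a ∷ b ∷ c ∷ xs ↭ c ∷ b ∷ a ∷ xs
    reverse xs = ↭-trans (↭-prep a (↭-swap b c ↭-refl)) (↭-trans (↭-swap a c ↭-refl) (↭-prep c (↭-swap a b ↭-refl)))

  -- The edges `ab` and `bc` provide each of the three vertices with a neighbour of degree other
  -- than four; with minimum degree four this makes all three givers.
  record HeavyTriangle (u : Fin N) : Set where
    field
      {a b c} : Fin N
      unique  : Unique (a ∷ b ∷ c ∷ [])
      edges   : All (Edge u) (a ∷ b ∷ c ∷ [])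
      ab      : Edge a b
      bc      : Edge b c
      heavy   : All (λ v → deg v ≢ 4) (a ∷ b ∷ c ∷ [])

  -- A triangle vertex of degree four is moved into the role of `a`, and `AdjacentPair` gives a cut.
  heavy-triangle : (∀ v → Vertex v → deg v ≡ 4 → K₄WithLeaf v) → 6 < size →
                   ∀ {u} → Vertex u → deg u ≡ 4 → Cut G ⊎ HeavyTriangle u
  heavy-triangle k₄ big {u} vu deg≡4 = decide (deg a ≟ⁿ 4) (deg b ≟ⁿ 4) (deg c ≟ⁿ 4)
    where
    K = k₄ u vu deg≡4
    open K₄WithLeaf K
    pair : (K′ : K₄WithLeaf u) → deg (K₄WithLeaf.a K′) ≡ 4 → Cut G
    pair K′ deg-a≡4 = AdjacentPair.cut-pair vu deg≡4 K′ deg-a≡4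
      (k₄ _ (edge-vertex (edge-sym (K₄WithLeaf.ua K′))) deg-a≡4) big
    decide : Dec (deg a ≡ 4) → Dec (deg b ≡ 4) → Dec (deg c ≡ 4) → Cut G ⊎ HeavyTriangle u
    decide (yes p) _ _ = inj₁ (pair K p)
    decide (no _) (yes p) _ = inj₁ (pair (swap-ab K) p)
    decide (no _) (no _) (yes p) = inj₁ (pair (swap-ac K) p)
    decide (no p) (no q) (no r) = inj₂ (record
      { unique = unique₃ unique ; edges = ua ∷ ub ∷ uc ∷ [] ; ab = ab ; bc = bc ; heavy = p ∷ q ∷ r ∷ [] })
      where
      unique₃ : Unique (a ∷ b ∷ c ∷ d ∷ []) → Unique (a ∷ b ∷ c ∷ [])
      unique₃ ((p ∷ q ∷ _) ∷ (r ∷ _) ∷ _) = (p ∷ q ∷ []) ∷ (r ∷ []) ∷ [] ∷ []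

  -- A vertex of degree at least five with a neighbour of degree other than four
  -- sends charge 2 to each neighbour of degree four, starting from charge 15 deg v.
  module Discharging (4≤deg : ∀ v → Vertex v → 4 ≤ deg v)
    (heavy-triangles : ∀ v → Vertex v → deg v ≡ 4 → HeavyTriangle v) where

    Giver : Fin N → Set
    Giver v = 5 ≤ deg v × ∃[ w ] (Edge v w × deg w ≢ 4)

    giver? : Decidable Giver
    giver? v = 5 ≤? deg v ×-dec any? λ w → edge? v w ×-dec ¬? (deg w ≟ⁿ 4)

    Gives : Fin N → Fin N → Set
    Gives v u = Giver v × deg u ≡ 4 × Edge v u

    gives? : ∀ v u → Dec (Gives v u)
    gives? v u = giver? v ×-dec deg u ≟ⁿ 4 ×-dec edge? v u

    given received : Fin N → ℕ
    given v    = count (gives? v)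
    received u = count (λ v → gives? v u)

    given≤deg : ∀ v → given v ≤ deg v
    given≤deg v = count-mono (gives? v) (edge? v) (λ _ (_ , _ , e) → e)

    given-nongiver : ∀ v → ¬ Giver v → given v ≡ 0
    given-nongiver v ¬g = count-empty (gives? v) (λ _ (g , _) → ¬g g)

    -- The neighbour of degree other than four receives nothing.
    given<deg : ∀ v → Giver v → given v + 1 ≤ deg v
    given<deg v (_ , w , vw , deg≢4) = ≤-trans
      (+-monoʳ-≤ (given v) (≤-reflexive (sym (count-singleton w))))
      (count-disjoint (edge? v) (gives? v) (_≟ w) (λ _ (_ , _ , e) → e) (λ { _ refl → vw })
        (λ { _ (_ , deg≡4 , _) refl → deg≢4 deg≡4 }))

    3≤received : ∀ v → Vertex v → deg v ≡ 4 → 3 ≤ received v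
    3≤received v vv deg≡4 = length≤count (λ w → gives? w v) unique (giving edges heavy)
      where
      open HeavyTriangle (heavy-triangles v vv deg≡4)
      gives : ∀ {x y} → Edge v x → deg x ≢ 4 → Edge x y → deg y ≢ 4 → Gives x v
      gives {x} vx x≢4 xy y≢4 =
        (≤∧≢⇒< (4≤deg x (edge-vertex xy)) (≢-sym x≢4) , _ , xy , y≢4) , deg≡4 , edge-sym vx
      giving : All (Edge v) (a ∷ b ∷ c ∷ []) → All (λ x → deg x ≢ 4) (a ∷ b ∷ c ∷ []) →
               All (λ x → Gives x v) (a ∷ b ∷ c ∷ [])
      giving (va ∷ vb ∷ vc ∷ []) (a≢4 ∷ b≢4 ∷ c≢4 ∷ []) =
        gives va a≢4 ab b≢4 ∷ gives vb b≢4 bc c≢4 ∷ gives vc c≢4 (edge-sym bc) b≢4 ∷ []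

    -- The average degree `22/5`, scaled by `15`, is `66`; `given` stands on the left to avoid
    -- subtraction. Degree four ends with at least `60 + 2 * 3`. Degree five gives away at most
    -- `2 * 4` of `75`. Degree `d` at least six keeps at least `13 * d`, hence `78`.
    66≤charge : ∀ v → Vertex v → 66 + 2 * given v ≤ 15 * deg v + 2 * received v
    66≤charge v vv = by-degree (deg v ≟ⁿ 4) (deg v ≟ⁿ 5) (giver? v)
      where
      open ≤-Reasoning
      by-degree : Dec (deg v ≡ 4) → Dec (deg v ≡ 5) → Dec (Giver v) →
                  66 + 2 * given v ≤ 15 * deg v + 2 * received v
      by-degree (yes deg≡4) _ _ = begin
        66 + 2 * given v              ≡⟨ cong (λ k → 66 + 2 * k) (given-nongiver v ¬giver) ⟩
        60 + 2 * 3                    ≤⟨ +-monoʳ-≤ 60 (*-monoʳ-≤ 2 (3≤received v vv deg≡4)) ⟩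
        60 + 2 * received v           ≡⟨ cong (λ k → 15 * k + 2 * received v) deg≡4 ⟨
        15 * deg v + 2 * received v   ∎
        where
        ¬giver : ¬ Giver v
        ¬giver (5≤deg , _) = <⇒≢ 5≤deg (sym deg≡4)
      by-degree (no _) (yes deg≡5) (yes g) = begin
        66 + 2 * given v              ≤⟨ +-monoʳ-≤ 66 (*-monoʳ-≤ 2 given≤4) ⟩
        66 + 2 * 4                    ≤⟨ m≤m+n 74 1 ⟩
        15 * 5                        ≡⟨ cong (15 *_) deg≡5 ⟨
        15 * deg v                    ≤⟨ m≤m+n _ _ ⟩
        15 * deg v + 2 * received v   ∎
        where
        given≤4 : given v ≤ 4
        given≤4 = +-cancelʳ-≤ 1 (given v) 4 (≤-trans (given<deg v g) (≤-reflexive deg≡5))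
      by-degree (no _) (yes deg≡5) (no ¬g) = begin
        66 + 2 * given v              ≡⟨ cong (λ k → 66 + 2 * k) (given-nongiver v ¬g) ⟩
        66                            ≤⟨ m≤m+n 66 9 ⟩
        15 * 5                        ≡⟨ cong (15 *_) deg≡5 ⟨
        15 * deg v                    ≤⟨ m≤m+n _ _ ⟩
        15 * deg v + 2 * received v   ∎
      by-degree (no deg≢4) (no deg≢5) _ = begin
        66 + 2 * given v              ≤⟨ +-monoʳ-≤ 66 (*-monoʳ-≤ 2 (given≤deg v)) ⟩
        66 + 2 * deg v                ≤⟨ +-monoˡ-≤ (2 * deg v) (m≤m+n 66 12) ⟩
        13 * 6 + 2 * deg v            ≤⟨ +-monoˡ-≤ (2 * deg v) (*-monoʳ-≤ 13 6≤deg) ⟩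
        13 * deg v + 2 * deg v        ≡⟨ *-distribʳ-+ (deg v) 13 2 ⟨
        15 * deg v                    ≤⟨ m≤m+n _ _ ⟩
        15 * deg v + 2 * received v   ∎
        where
        6≤deg : 6 ≤ deg v
        6≤deg = ≤∧≢⇒< (≤∧≢⇒< (4≤deg v vv) (≢-sym deg≢4)) (≢-sym deg≢5)

    charge : ∀ v (d : Dec (Vertex v)) → 66 * 𝟙 d + 2 * given v ≤ 15 * deg v + 2 * received v
    charge v (yes vv) = 66≤charge v vv
    charge v (no _)   = ≤-trans
      (*-mono-≤ (m≤m+n 2 13) (given≤deg v)) (m≤m+n (15 * deg v) (2 * received v))

    sum-linear : ∀ k l (f g : Fin N → ℕ) → sum (λ v → k * f v + l * g v) ≡ k * sum f + l * sum g
    sum-linear k l f g = trans (∑-distrib-+ (λ v → k * f v) (λ v → l * g v))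
      (cong₂ _+_ (sym (*-distribˡ-sum +-*-semiring k f)) (sym (*-distribˡ-sum +-*-semiring l g)))

    -- The total given equals the total received, by exchanging the order of summation, and cancels.
    66size≤15degreeSum : 66 * size ≤ 15 * degreeSum
    66size≤15degreeSum = +-cancelʳ-≤ (2 * sum given) _ _ (begin
      66 * size + 2 * sum given
        ≡⟨ sum-linear 66 2 (λ v → 𝟙 (vertex? v)) given ⟨
      sum (λ v → 66 * 𝟙 (vertex? v) + 2 * given v)
        ≤⟨ sum-mono (λ v → charge v (vertex? v)) ⟩
      sum (λ v → 15 * deg v + 2 * received v)
        ≡⟨ sum-linear 15 2 deg received ⟩
      15 * degreeSum + 2 * sum received
        ≡⟨ cong (λ k → 15 * degreeSum + 2 * k) (∑-comm (λ v u → 𝟙 (gives? v u))) ⟨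
      15 * degreeSum + 2 * sum given ∎)
      where open ≤-Reasoning

    contradictory : ⊥
    contradictory = <-irrefl refl (begin-strict
      15 * degreeSum            ≤⟨ m≤m+n _ 108 ⟩
      15 * degreeSum + 108      ≡⟨ solve 1 (λ d → con 15 :* d :+ con 108 := con 3 :* (con 5 :* d :+ con 36))
                                   refl degreeSum ⟩
      3 * (5 * degreeSum + 36)  <⟨ *-monoʳ-< 3 sparse ⟩
      3 * (22 * size)           ≡⟨ *-assoc 3 22 size ⟨
      66 * size                 ≤⟨ 66size≤15degreeSum ⟩
      15 * degreeSum            ∎)
      where
      open ≤-Reasoning
      open +-*-Solver

  -- Low degrees, small orders and the induction step

  -- The last condition keeps a vertex outside `v` and its neighbours for the right side of the cut.
  LowDegree : Fin N → Set
  LowDegree v = Vertex v × deg v ≤ 2 × 2 + deg v ≤ size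

  lowDegree? : Decidable LowDegree
  lowDegree? v = vertex? v ×-dec deg v ≤? 2 ×-dec 2 + deg v ≤? size

  cut-low-degree : ∀ {v} → LowDegree v → Cut G
  cut-low-degree {v} (vv , deg≤2 , room) with enumerate (edge? v)
  ... | xs , nbrs , len =
    cut-at vv (Enumeration.complete nbrs) (short xs (≤-trans (≤-reflexive len) deg≤2))
              (≤-trans (≤-reflexive (cong (2 +_) len)) room)
    where
    short : ∀ xs → length xs ≤ 2 → Eliminable G xs
    short []          _ = []
    short (x ∷ [])     _ = leaf-[] G ∷ []
    short (x ∷ y ∷ []) _ = leaf-[-] G ∷ leaf-[] G ∷ []
    short (x ∷ y ∷ z ∷ zs) (s≤s (s≤s ()))

  -- Without a vertex of low degree a graph on at most four vertices is complete.
  ¬small : (∀ v → ¬ LowDegree v) → ¬ (size ≤ 4)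
  ¬small none size≤4 = impossible size size≤4 (begin-strict
    5 * (size * size) + 36          ≤⟨ +-monoˡ-≤ 36 (*-monoʳ-≤ 5 complete) ⟩
    5 * (degreeSum + size) + 36     ≡⟨ solve 2 (λ d s → con 5 :* (d :+ s) :+ con 36
                                            := con 5 :* d :+ con 36 :+ con 5 :* s) refl degreeSum size ⟩
    5 * degreeSum + 36 + 5 * size   <⟨ +-monoˡ-< (5 * size) sparse ⟩
    22 * size + 5 * size            ≡⟨ *-distribʳ-+ size 22 5 ⟨
    27 * size                       ∎)
    where
    open ≤-Reasoning
    open +-*-Solver
    -- At `s = 3` both sides equal `81`, so the strict inequality is essential.
    impossible : ∀ s → s ≤ 4 → ¬ (5 * (s * s) + 36 < 27 * s)
    impossible 0 _ ()
    impossible 1 _ h = contradiction h (<⇒≱ (m≤m+n 28 14))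
    impossible 2 _ h = contradiction h (<⇒≱ (m≤m+n 55 2))
    impossible 3 _ h = contradiction h (<⇒≱ (m≤m+n 82 0))
    impossible 4 _ h = contradiction h (<⇒≱ (m≤m+n 109 8))
    impossible (suc (suc (suc (suc (suc _))))) (s≤s (s≤s (s≤s (s≤s ())))) _
    row : ∀ v (d : Dec (Vertex v)) → size * 𝟙 d ≤ deg v + 𝟙 d
    row v (no _)   = ≤-trans (≤-reflexive (*-zeroʳ size)) z≤n
    row v (yes vv) = ≤-trans (≤-reflexive (*-identityʳ size)) (≤-trans large (≤-reflexive (+-comm 1 (deg v))))
      where
      large : size ≤ suc (deg v)
      large with deg v ≤? 2 | 2 + deg v ≤? size
      ... | yes low | yes room = contradiction (vv , low , room) (none v)
      ... | yes _   | no full  = ≤-pred (≰⇒> full)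
      ... | no high | _        = ≤-trans size≤4 (s≤s (≰⇒> high))
    complete : size * size ≤ degreeSum + size
    complete = begin
      size * size                         ≡⟨ *-distribˡ-sum +-*-semiring size (λ v → 𝟙 (vertex? v)) ⟩
      sum (λ v → size * 𝟙 (vertex? v))    ≤⟨ sum-mono (λ v → row v (vertex? v)) ⟩
      sum (λ v → deg v + 𝟙 (vertex? v))   ≡⟨ ∑-distrib-+ deg (λ v → 𝟙 (vertex? v)) ⟩
      degreeSum + size                    ∎

  -- A degree sum of at least `4 * size` turns sparsity into `36 < 2 * size`. This leaves room for
  -- all cuts around a vertex or a pair.
  18<size : (∀ v → Vertex v → 4 ≤ deg v) → 18 < size
  18<size 4≤deg = *-cancelˡ-< 2 18 size (+-cancelˡ-< (20 * size) 36 (2 * size) (begin-strict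
    20 * size + 36           ≡⟨ cong (_+ 36) (*-assoc 5 4 size) ⟩
    5 * (4 * size) + 36      ≤⟨ +-monoˡ-≤ 36 (*-monoʳ-≤ 5 4size≤degreeSum) ⟩
    5 * degreeSum + 36       <⟨ sparse ⟩
    22 * size                ≡⟨ *-distribʳ-+ size 20 2 ⟩
    20 * size + 2 * size     ∎))
    where
    open ≤-Reasoning
    row : ∀ v (d : Dec (Vertex v)) → 4 * 𝟙 d ≤ deg v
    row v (yes vv) = 4≤deg v vv
    row v (no _)   = z≤n
    4size≤degreeSum : 4 * size ≤ degreeSum
    4size≤degreeSum = ≤-trans (≤-reflexive (*-distribˡ-sum +-*-semiring 4 (λ v → 𝟙 (vertex? v))))
                              (sum-mono (λ v → row v (vertex? v)))

  for-all-vertices : ∀ {Q : Fin N → Set} → (∀ v → Vertex v → Cut G ⊎ Q v) → Cut G ⊎ (∀ v → Vertex v → Q v)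
  for-all-vertices {Q} f = choose-all λ v → on-vertex v (vertex? v)
    where
    on-vertex : ∀ v → Dec (Vertex v) → Cut G ⊎ (Vertex v → Q v)
    on-vertex v (yes vv) = map₂ (λ q _ → q) (f v vv)
    on-vertex v (no ¬vv) = inj₂ (λ vv → contradiction vv ¬vv)

  cut-or-minimum-degree-four : (∀ v → ¬ LowDegree v) → ∀ v → Vertex v → Cut G ⊎ 4 ≤ deg v
  cut-or-minimum-degree-four none v vv with deg v ≤? 2 | deg v ≟ⁿ 3
  ... | yes low  | _         = contradiction (vv , low , ≤-trans (+-monoʳ-≤ 2 low) (<⇒≤ (≰⇒> (¬small none)))) (none v)
  ... | no _     | yes deg≡3 = inj₁ (degree-three vv deg≡3 (≰⇒> (¬small none)))
  ... | no 2≱deg | no deg≢3  = inj₂ (≤∧≢⇒< (≰⇒> 2≱deg) (≢-sym deg≢3))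

  when-degree-four : ∀ {Q : Fin N → Set} → (∀ {v} → Vertex v → deg v ≡ 4 → Cut G ⊎ Q v) →
                     ∀ v → Vertex v → Cut G ⊎ (deg v ≡ 4 → Q v)
  when-degree-four f v vv with deg v ≟ⁿ 4
  ... | yes deg≡4 = map₂ (λ q _ → q) (f vv deg≡4)
  ... | no deg≢4  = inj₂ (λ deg≡4 → contradiction deg≡4 deg≢4)

  cliques : (∀ v → Vertex v → 4 ≤ deg v) → Cut G ⊎ (∀ v → Vertex v → deg v ≡ 4 → K₄WithLeaf v)
  cliques 4≤deg = for-all-vertices (when-degree-four λ vv deg≡4 →
    DegreeFour.classify vv deg≡4 (≤-trans (m≤m+n 6 13) (18<size 4≤deg)))

  triangles : (∀ v → Vertex v → 4 ≤ deg v) → (∀ v → Vertex v → deg v ≡ 4 → K₄WithLeaf v) →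
              Cut G ⊎ (∀ v → Vertex v → deg v ≡ 4 → HeavyTriangle v)
  triangles 4≤deg k₄ = for-all-vertices (when-degree-four
    (heavy-triangle k₄ (≤-trans (m≤m+n 7 12) (18<size 4≤deg))))

  _or-else_ : ∀ {A : Set₁} {C : Set} → A ⊎ C → (C → A) → A
  inj₁ a or-else _ = a
  inj₂ c or-else f = f c

  no-low-degree : (∀ v → ¬ LowDegree v) → Cut G
  no-low-degree none =
    for-all-vertices (cut-or-minimum-degree-four none) or-else λ 4≤deg →
    cliques 4≤deg or-else λ k₄ →
    triangles 4≤deg k₄ or-else λ heavy →
    ⊥-elim (Discharging.contradictory 4≤deg heavy)

  find-cut : Cut G
  find-cut = decide (any? lowDegree?)
    where
    decide : Dec (∃ LowDegree) → Cut G
    decide (yes (_ , low)) = cut-low-degree low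
    decide (no none)       = no-low-degree (λ v low → none (v , low))

sparse⇒cut : ∀ {N} (G : PartialGraph N) → PartialGraph.Sparse G → Cut G
sparse⇒cut {N} G = <-rec (λ k → (G : PartialGraph N) → size G ≡ k → Sparse G → Cut G)
  (λ { _ rec G refl sparse → Reduction.find-cut G sparse (λ G′ smaller → rec smaller G′ refl) })
  (size G) G refl
  where open PartialGraph

-- Back to vertex cuts and cycles

module _ {n : ℕ} (G : Graph n) where

  adj-sym : ∀ {x y} → Adj G x y → Adj G y x
  adj-sym {x} {y} = subst T (symmetric G x y)

  total : PartialGraph n
  total = record
    { Vertex      = λ _ → ⊤
    ; vertex?     = λ _ → yes tt
    ; Edge        = Adj G
    ; edge?       = λ x y → T? (adj G x y)
    ; edge-sym    = adj-sym
    ; edge-irrefl = λ {x} → subst T (irreflexive G x)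
    ; edge-vertex = λ _ → tt
    }

  size-total : PartialGraph.size total ≡ n
  size-total = ones n
    where
    ones : ∀ m → count {m} {λ _ → ⊤} (λ _ → yes tt) ≡ m
    ones zero    = refl
    ones (suc m) = cong suc (ones m)

  sum-allFin : ∀ {m} (f : Fin m → ℕ) → ListAction.sum (List.map f (allFin m)) ≡ sum f
  sum-allFin {m} f = trans (cong ListAction.sum (map-tabulate id f)) (sum-tabulate f)
    where
    sum-tabulate : ∀ {m} (f : Fin m → ℕ) → ListAction.sum (List.tabulate f) ≡ sum f
    sum-tabulate {zero}  f = refl
    sum-tabulate {suc m} f = cong (f zero +_) (sum-tabulate (f ∘ suc))

  entry : Fin n → Fin n → ℕ
  entry i j = if ⌊ toℕ i <? toℕ j ⌋ ∧ adj G i j then 1 else 0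

  -- `edgeCount` sees a pair in increasing order only; on the diagonal both sides vanish by
  -- irreflexivity.
  entry-sym : ∀ i j → entry i j + entry j i ≡ 𝟙 (T? (adj G i j))
  entry-sym i j with toℕ i <? toℕ j | toℕ j <? toℕ i
  ... | yes i<j | yes j<i = contradiction j<i (<-asym i<j)
  ... | yes _   | no _    = +-identityʳ _
  ... | no _    | yes _   = cong (λ b → if b then 1 else 0) (symmetric G j i)
  ... | no i≮j  | no j≮i with toℕ-injective (≤-antisym (≮⇒≥ j≮i) (≮⇒≥ i≮j))
  ... | refl = cong (λ b → if b then 1 else 0) (sym (irreflexive G i))

  -- The handshake lemma: the matrix of `entry` plus its transpose is the adjacency matrix.
  degreeSum-total : PartialGraph.degreeSum total ≡ 2 * edgeCount G
  degreeSum-total = sym (begin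
    2 * edgeCount G
      ≡⟨ cong (2 *_) (trans (sum-allFin (λ i → ListAction.sum (List.map (entry i) (allFin n))))
                            (sum-cong-≗ (λ i → sum-allFin (entry i)))) ⟩
    2 * ∑entry
      ≡⟨ cong (∑entry +_) (+-identityʳ ∑entry) ⟩
    ∑entry + ∑entry
      ≡⟨ cong (∑entry +_) (∑-comm entry) ⟩
    ∑entry + sum (λ i → sum (λ j → entry j i))
      ≡⟨ ∑-distrib-+ (λ i → sum (entry i)) (λ i → sum (λ j → entry j i)) ⟨
    sum (λ i → sum (entry i) + sum (λ j → entry j i))
      ≡⟨ sum-cong-≗ (λ i → trans (sym (∑-distrib-+ (entry i) (λ j → entry j i)))
                                 (sum-cong-≗ (entry-sym i))) ⟩
    PartialGraph.degreeSum total ∎)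
    where
    open ≡-Reasoning
    ∑entry = sum (λ i → sum (entry i))

  Branches : (Fin n → Set) → Fin n → Set
  Branches P x = ∃[ y ] ∃[ z ] (y ≢ z × (P y × Adj G x y) × (P z × Adj G x z))

  last-∈ : ∀ {x w : Fin n} xs → last (x ∷ xs) ≡ just w → w ∈ x ∷ xs
  last-∈ []       refl = here refl
  last-∈ (_ ∷ xs) eq   = there (last-∈ xs eq)

  -- q is the first vertex of the cycle and p the predecessor of x.
  path-branches : ∀ {P p q w} x xs → P p → P q → (∀ {y} → y ∈ x ∷ xs → P y) →
    Linked (Adj G) (p ∷ x ∷ xs) → All (p ≢_) (x ∷ xs) → All (q ≢_) (x ∷ xs) → Unique (x ∷ xs) →
    last (x ∷ xs) ≡ just w → Adj G w q → (xs ≡ [] → p ≢ q) → All (Branches P) (x ∷ xs)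
  path-branches x [] pp pq pxs (px ∷ _) _ _ _ refl wq p≢q =
    (_ , _ , p≢q refl , (pp , adj-sym px) , (pq , wq)) ∷ []
  path-branches x (z ∷ xs) pp pq pxs (px ∷ xz ∷ link) (_ ∷ p≢z ∷ _) (q≢x ∷ q≢) (x≢ ∷ uxs) eq wq _ =
    (_ , z , p≢z , (pp , adj-sym px) , (pxs (there (here refl)) , xz)) ∷
    path-branches z xs (pxs (here refl)) pq (pxs ∘ there) (xz ∷ link) x≢ q≢ uxs eq wq (λ _ → ≢-sym q≢x)

  cycle⇒core : ∀ {S} c → CycleIn G S c → Core total (_∈ c)
  cycle⇒core (v ∷ []) (s≤s () , _)
  cycle⇒core (v ∷ x ∷ []) (s≤s (s≤s ()) , _)
  cycle⇒core (v ∷ x ∷ y ∷ ys) (_ , v≢@(_ ∷ _) ∷ uxs@(x≢ ∷ _) , _ , vx ∷ link , w , eq , wv) = record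
    { inhabited = v , here refl
    -- At the start `p` and `q` are both `v`; their distinctness is demanded only at the last
    -- vertex, and `y ∷ ys` is nonempty.
    ; branching = All.lookup (first ∷ path-branches x (y ∷ ys) (here refl) (here refl) there
                                        (vx ∷ link) v≢ v≢ uxs eq wv λ ())
    }
    where
    first : Branches (_∈ v ∷ x ∷ y ∷ ys) v
    -- The first vertex has the second and the last as neighbours, distinct because the cycle has
    -- length at least three.
    first = x , w , All.lookup x≢ (last-∈ ys eq) , (there (here refl) , vx) ,
            (there (there (last-∈ ys eq)) , adj-sym wv)

  cut⇒forestCut : Cut total → ∃[ S ] ForestCut G S
  cut⇒forestCut C = S , (u , v , ∉S sideU (λ ()) , ∉S sideV (λ ()) , ¬reach) , acyclic
    where
    open Cut C
    S : Subset n
    S = Vec.tabulate (λ x → does (side x ≟ˢ cut))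
    u = proj₁ on-left
    v = proj₁ on-right
    sideU : side u ≡ left
    sideU = proj₂ (proj₂ on-left)
    sideV : side v ≡ right
    sideV = proj₂ (proj₂ on-right)
    ∈S⇒cut : ∀ {x} → x ∈ₛ S → side x ≡ cut
    ∈S⇒cut {x} x∈S with trans (sym (lookup∘tabulate _ x)) ([]=⇒lookup x∈S)
    ... | eq with side x | eq
    ... | cut | _ = refl
    cut⇒∈S : ∀ {x} → side x ≡ cut → x ∈ₛ S
    cut⇒∈S {x} eq = lookup⇒[]= x S (trans (lookup∘tabulate _ x) (cong (λ s → does (s ≟ˢ cut)) eq))
    ∉S : ∀ {x s} → side x ≡ s → s ≢ cut → x ∉ S
    ∉S eq s≢cut x∈S = s≢cut (trans (sym eq) (∈S⇒cut x∈S))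
    start : ∀ {x y} → ReachAvoiding G S x y → x ∉ S
    start (here x∉S)     = x∉S
    start (step x∉S _ _) = x∉S
    stays-left : ∀ {x y} → ReachAvoiding G S x y → side x ≡ left → side y ≡ left
    stays-left (here _) l = l
    stays-left (step {w = w} _ xw path) l with side w in eq
    ... | left  = stays-left path eq
    ... | right = ⊥-elim (separated xw l eq)
    ... | cut   = contradiction (cut⇒∈S eq) (start path)
    ¬reach : ¬ ReachAvoiding G S u v
    ¬reach path = case trans (sym (stays-left path sideU)) sideV of λ ()
    acyclic : InducedForest G S
    acyclic (x ∷ xs) cyc@(_ , _ , ⊆S , _) =
      forest (cycle⇒core (x ∷ xs) cyc) (λ p → ∈S⇒cut (All.lookup ⊆S p))

theorem2 : ∀ (n : ℕ) (G : Graph n) → 5 * edgeCount G + 18 < 11 * n →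
    ∃[ S ] ForestCut G S
theorem2 n G few = cut⇒forestCut G (sparse⇒cut (total G) (begin-strict
  5 * PartialGraph.degreeSum (total G) + 36   ≡⟨ cong (λ d → 5 * d + 36) (degreeSum-total G) ⟩
  5 * (2 * edgeCount G) + 36                  ≡⟨ solve 1 (λ m → con 5 :* (con 2 :* m) :+ con 36
                                                     := con 2 :* (con 5 :* m :+ con 18)) refl (edgeCount G) ⟩
  2 * (5 * edgeCount G + 18)                  <⟨ *-monoʳ-< 2 few ⟩
  2 * (11 * n)                                ≡⟨ *-assoc 2 11 n ⟨
  22 * n                                      ≡⟨ cong (22 *_) (size-total G) ⟨
  22 * PartialGraph.size (total G)            ∎))
  where
  open ≤-Reasoning
  open +-*-Solver
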